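{- For all integers $n\geq 1$ and $3\leq m\leq n+1$, one has $B_{n+1,m}=2\kappa_{n,m}$. Consequently, for all $n\ge 1$, $B_{n+1}=2^n+2\kappa_n$.
   Context: For a positive integer $N$, a collection $\Phi\subseteq 2^{[N]}$ is balanced if there exist positive real weights $(\lambda_S)_{S\in\Phi}$ with $\sum_{S\in\Phi}\lambda_S\mathbf{1}_S=(1,\dots,1)^{\mathsf T}\in\mathbb{R}^N$, where $\mathbf{1}_S$ is the characteristic vector of $S$. A balanced collection is minimal if none of its proper subcollections is balanced. $B_{N,m}$ is the number of minimal balanced collections on $[N]$ consisting of exactly $m$ subsets, and $B_N$ is the total number of minimal balanced collections on $[N]$. The resonance arrangement is $\mathcal{A}_n:=\{H_S:\varnothing\ne S\subseteq[n]\}$ with $H_S:=\{x\in\mathbb{R}^n:\sum_{j\in S}x_j=0\}$; the hyperplane $H_S$ is associated with its normal vector $\mathbf{1}_S$, so the normals are precisely the nonzero vectors of $\{0,1\}^n$. A circuit of $\mathcal{A}_n$ is an inclusion-minimal linearly dependent (over $\mathbb{R}$) set of these normal vectors. $\kappa_{n,m}$ is the number of $m$-element circuits of $\mathcal{A}_n$, and $\kappa_n$ is the total number of circuits of $\mathcal{A}_n$. -}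

module Defs where

open import Data.Bool using (if_then_else_)
open import Data.Fin using (Fin)
open import Data.Fin.Permutation using (↔⇒≡)
open import Data.Fin.Subset using (Subset; Nonempty)
open import Data.List using (List; length; map; foldr)
open import Data.List.Relation.Binary.BagAndSetEquality using ([_]-Equality; set)
import Data.List.Relation.Binary.Subset.Propositional as List
open import Data.List.Relation.Unary.All using (All)
open import Data.List.Relation.Unary.Any using (Any)
open import Data.List.Relation.Unary.Unique.Propositional using (Unique)
open import Data.Integer as ℤ using ()
open import Data.Nat as ℕ using (ℕ)
import Data.Nat.Properties as ℕ
open import Data.Product using (Σ; ∃-syntax; _×_; _,_; proj₁; proj₂)
open import Data.Rational as ℚ using (ℚ; 0ℚ; 1ℚ; ½; ∣_∣)
import Data.Rational.Properties as ℚ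
open import Data.Rational.Solver using (module +-*-Solver)
open import Data.Vec using (lookup)
open import Function.Bundles using (Inverse)
import Function.Construct.Composition as Compose
import Function.Construct.Symmetry as Symmetry
open import Relation.Binary.Bundles using (Setoid)
import Relation.Binary.Construct.On as On
open import Relation.Binary.PropositionalEquality as ≡ using (_≡_; refl)
open import Relation.Nullary using (¬_)

-- ℝ is a setoid: equality of reals is _≃_, not _≡_.

IsCauchy : (ℕ → ℚ) → Set
IsCauchy x = ∀ ε → 0ℚ ℚ.< ε →
  ∃[ k ] (∀ m n → k ℕ.≤ m → k ℕ.≤ n → ∣ x m ℚ.- x n ∣ ℚ.< ε)

record ℝ : Set where
  constructor mkℝ
  field
    seq    : ℕ → ℚ
    cauchy : IsCauchy seq

open ℝ public

infix 4 _≃_ _<_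

_≃_ : ℝ → ℝ → Set
x ≃ y = ∀ ε → 0ℚ ℚ.< ε →
  ∃[ k ] (∀ n → k ℕ.≤ n → ∣ seq x n ℚ.- seq y n ∣ ℚ.< ε)

_<_ : ℝ → ℝ → Set
x < y = ∃[ ε ] (0ℚ ℚ.< ε × ∃[ k ] (∀ n → k ℕ.≤ n → seq x n ℚ.+ ε ℚ.< seq y n))

fromℚ : ℚ → ℝ
fromℚ p = mkℝ (λ _ → p) λ ε 0<ε → 0 , λ _ _ _ _ →
  ≡.subst (λ q → ∣ q ∣ ℚ.< ε) (≡.sym (ℚ.+-inverseʳ p)) 0<ε

0ℝ 1ℝ : ℝ
0ℝ = fromℚ 0ℚ
1ℝ = fromℚ 1ℚ

private
  pos-* : ∀ {p q} → 0ℚ ℚ.< p → 0ℚ ℚ.< q → 0ℚ ℚ.< p ℚ.* q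
  pos-* {p} {q} 0<p 0<q = ℚ.positive⁻¹ (p ℚ.* q)
    where instance
      p⁺  = ℚ.positive 0<p
      q⁺  = ℚ.positive 0<q
      pq⁺ = ℚ.pos*pos⇒pos p q

  0<½ : 0ℚ ℚ.< ½
  0<½ = ℚ.positive⁻¹ ½

  ½<1 : ½ ℚ.< 1ℚ
  ½<1 = ℚ.*<* (ℤ.+<+ (ℕ.s≤s (ℕ.s≤s ℕ.z≤n)))

  abstract
    +-cauchy : ∀ {x y} → IsCauchy x → IsCauchy y → IsCauchy (λ n → x n ℚ.+ y n)
    +-cauchy {x} {y} cx cy ε 0<ε
      with k , hx ← cx (½ ℚ.* ε) (pos-* 0<½ 0<ε)
         | l , hy ← cy (½ ℚ.* ε) (pos-* 0<½ 0<ε)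
      = k ℕ.⊔ l , λ m n km kn → begin-strict
        ∣ (x m ℚ.+ y m) ℚ.- (x n ℚ.+ y n) ∣      ≡⟨ ≡.cong ∣_∣ (rearrange (x m) (y m) (x n) (y n)) ⟩
        ∣ (x m ℚ.- x n) ℚ.+ (y m ℚ.- y n) ∣      ≤⟨ ℚ.∣p+q∣≤∣p∣+∣q∣ (x m ℚ.- x n) (y m ℚ.- y n) ⟩
        ∣ x m ℚ.- x n ∣ ℚ.+ ∣ y m ℚ.- y n ∣      <⟨ ℚ.+-mono-<
                                                     (hx m n (ℕ.m⊔n≤o⇒m≤o k l km) (ℕ.m⊔n≤o⇒m≤o k l kn))
                                                     (hy m n (ℕ.m⊔n≤o⇒n≤o k l km) (ℕ.m⊔n≤o⇒n≤o k l kn)) ⟩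
        ½ ℚ.* ε ℚ.+ ½ ℚ.* ε                      ≡⟨ ℚ.*-distribʳ-+ ε ½ ½ ⟨
        1ℚ ℚ.* ε                                 ≡⟨ ℚ.*-identityˡ ε ⟩
        ε                                        ∎
      where
      open ℚ.≤-Reasoning
      open +-*-Solver
      rearrange : ∀ a b c d → (a ℚ.+ b) ℚ.- (c ℚ.+ d) ≡ (a ℚ.- c) ℚ.+ (b ℚ.- d)
      rearrange = solve 4 (λ a b c d → (a :+ b) :- (c :+ d) := (a :- c) :+ (b :- d)) refl

  cauchy⇒bounded : ∀ {x} → IsCauchy x →
    ∃[ b ] (0ℚ ℚ.< b × ∃[ k ] (∀ n → k ℕ.≤ n → ∣ x n ∣ ℚ.≤ b))
  cauchy⇒bounded {x} cx with k , h ← cx 1ℚ (ℚ.positive⁻¹ 1ℚ)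
    = 1ℚ ℚ.+ ∣ x k ∣
    , ℚ.+-mono-<-≤ (ℚ.positive⁻¹ 1ℚ) (ℚ.0≤∣p∣ (x k))
    , k , λ n kn → begin
      ∣ x n ∣                         ≡⟨ ≡.cong ∣_∣ (split (x n) (x k)) ⟩
      ∣ (x n ℚ.- x k) ℚ.+ x k ∣       ≤⟨ ℚ.∣p+q∣≤∣p∣+∣q∣ (x n ℚ.- x k) (x k) ⟩
      ∣ x n ℚ.- x k ∣ ℚ.+ ∣ x k ∣     ≤⟨ ℚ.+-monoˡ-≤ ∣ x k ∣ (ℚ.<⇒≤ (h n k kn ℕ.≤-refl)) ⟩
      1ℚ ℚ.+ ∣ x k ∣                  ∎
    where
    open ℚ.≤-Reasoning
    open +-*-Solver
    split : ∀ a b → a ≡ (a ℚ.- b) ℚ.+ b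
    split = solve 2 (λ a b → a := (a :- b) :+ b) refl

  ∣*∣-≤ : ∀ {p q r s} → ∣ p ∣ ℚ.≤ r → ∣ q ∣ ℚ.≤ s → ∣ p ℚ.* q ∣ ℚ.≤ r ℚ.* s
  ∣*∣-≤ {p} {q} {r} {s} p≤r q≤s = begin
      ∣ p ℚ.* q ∣        ≡⟨ ℚ.∣p*q∣≡∣p∣*∣q∣ p q ⟩
      ∣ p ∣ ℚ.* ∣ q ∣    ≤⟨ ℚ.*-monoʳ-≤-nonNeg ∣ q ∣ p≤r ⟩
      r ℚ.* ∣ q ∣        ≤⟨ ℚ.*-monoˡ-≤-nonNeg r q≤s ⟩
      r ℚ.* s            ∎
    where
    open ℚ.≤-Reasoning
    instance
      q⁺ = ℚ.nonNegative (ℚ.0≤∣p∣ q)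
      r⁺ = ℚ.nonNegative (ℚ.≤-trans (ℚ.0≤∣p∣ p) p≤r)

  shrink : ∀ c ε → 0ℚ ℚ.< c → 0ℚ ℚ.< ε → ∃[ δ ] (0ℚ ℚ.< δ × c ℚ.* δ ℚ.< ε)
  shrink c ε 0<c 0<ε = inv ℚ.* (½ ℚ.* ε) , pos-* {inv} {½ ℚ.* ε} 0<inv (pos-* {½} {ε} 0<½ 0<ε) , (begin-strict
      c ℚ.* (inv ℚ.* (½ ℚ.* ε))   ≡⟨ ℚ.*-assoc c inv (½ ℚ.* ε) ⟨
      c ℚ.* inv ℚ.* (½ ℚ.* ε)     ≡⟨ ≡.cong (ℚ._* (½ ℚ.* ε)) (ℚ.*-inverseʳ c) ⟩
      1ℚ ℚ.* (½ ℚ.* ε)            ≡⟨ ℚ.*-identityˡ (½ ℚ.* ε) ⟩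
      ½ ℚ.* ε                     <⟨ ℚ.*-monoˡ-<-pos ε ½<1 ⟩
      1ℚ ℚ.* ε                    ≡⟨ ℚ.*-identityˡ ε ⟩
      ε                           ∎)
    where
    open ℚ.≤-Reasoning
    instance
      c⁺ : ℚ.Positive c
      c⁺ = ℚ.positive 0<c
      c≢0 : ℚ.NonZero c
      c≢0 = ℚ.pos⇒nonZero c
      ε⁺ : ℚ.Positive ε
      ε⁺ = ℚ.positive 0<ε
    inv : ℚ
    inv = ℚ.1/ c
    0<inv : 0ℚ ℚ.< inv
    0<inv = ℚ.positive⁻¹ inv {{ℚ.1/pos⇒pos c}}

  *-close : ∀ p q r s {a b δ} → ∣ p ∣ ℚ.≤ a → ∣ s ∣ ℚ.≤ b →
    ∣ p ℚ.- r ∣ ℚ.≤ δ → ∣ q ℚ.- s ∣ ℚ.≤ δ → ∣ p ℚ.* q ℚ.- r ℚ.* s ∣ ℚ.≤ (a ℚ.+ b) ℚ.* δ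
  *-close p q r s {a} {b} {δ} p≤a s≤b pr qs = begin
      ∣ p ℚ.* q ℚ.- r ℚ.* s ∣                           ≡⟨ ≡.cong ∣_∣ (rearrange p q r s) ⟩
      ∣ p ℚ.* (q ℚ.- s) ℚ.+ (p ℚ.- r) ℚ.* s ∣           ≤⟨ ℚ.∣p+q∣≤∣p∣+∣q∣ (p ℚ.* (q ℚ.- s)) ((p ℚ.- r) ℚ.* s) ⟩
      ∣ p ℚ.* (q ℚ.- s) ∣ ℚ.+ ∣ (p ℚ.- r) ℚ.* s ∣       ≤⟨ ℚ.+-mono-≤ (∣*∣-≤ {p} {q ℚ.- s} p≤a qs) (∣*∣-≤ {p ℚ.- r} {s} pr s≤b) ⟩
      a ℚ.* δ ℚ.+ δ ℚ.* b                               ≡⟨ factor a b δ ⟩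
      (a ℚ.+ b) ℚ.* δ                                   ∎
    where
    open ℚ.≤-Reasoning
    open +-*-Solver
    rearrange : ∀ s t u v → s ℚ.* t ℚ.- u ℚ.* v ≡ s ℚ.* (t ℚ.- v) ℚ.+ (s ℚ.- u) ℚ.* v
    rearrange = solve 4 (λ s t u v → s :* t :- u :* v := s :* (t :- v) :+ (s :- u) :* v) refl
    factor : ∀ s t u → s ℚ.* u ℚ.+ u ℚ.* t ≡ (s ℚ.+ t) ℚ.* u
    factor = solve 3 (λ s t u → s :* u :+ u :* t := (s :+ t) :* u) refl

  abstract
    *-cauchy : ∀ {x y} → IsCauchy x → IsCauchy y → IsCauchy (λ n → x n ℚ.* y n)
    *-cauchy {x} {y} cx cy ε 0<ε =
      let a , 0<a , k₁ , ha = cauchy⇒bounded {x} cx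
          b , 0<b , k₂ , hb = cauchy⇒bounded {y} cy
          δ , 0<δ , small   = shrink (a ℚ.+ b) ε (ℚ.+-mono-< 0<a 0<b) 0<ε
          k₃ , hx           = cx δ 0<δ
          k₄ , hy           = cy δ 0<δ
      in
      (k₁ ℕ.⊔ k₂) ℕ.⊔ (k₃ ℕ.⊔ k₄) , λ m n km kn →
        let m₁₂ = ℕ.m⊔n≤o⇒m≤o (k₁ ℕ.⊔ k₂) (k₃ ℕ.⊔ k₄) km
            n₁₂ = ℕ.m⊔n≤o⇒m≤o (k₁ ℕ.⊔ k₂) (k₃ ℕ.⊔ k₄) kn
            m₃₄ = ℕ.m⊔n≤o⇒n≤o (k₁ ℕ.⊔ k₂) (k₃ ℕ.⊔ k₄) km
            n₃₄ = ℕ.m⊔n≤o⇒n≤o (k₁ ℕ.⊔ k₂) (k₃ ℕ.⊔ k₄) kn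
            dx  = hx m n (ℕ.m⊔n≤o⇒m≤o k₃ k₄ m₃₄) (ℕ.m⊔n≤o⇒m≤o k₃ k₄ n₃₄)
            dy  = hy m n (ℕ.m⊔n≤o⇒n≤o k₃ k₄ m₃₄) (ℕ.m⊔n≤o⇒n≤o k₃ k₄ n₃₄)
        in ℚ.≤-<-trans
             (*-close (x m) (y m) (x n) (y n)
               (ha m (ℕ.m⊔n≤o⇒m≤o k₁ k₂ m₁₂)) (hb n (ℕ.m⊔n≤o⇒n≤o k₁ k₂ n₁₂))
               (ℚ.<⇒≤ dx) (ℚ.<⇒≤ dy))
             small

infixl 6 _+_
infixl 7 _*_

_+_ : ℝ → ℝ → ℝ
x + y = mkℝ (λ n → seq x n ℚ.+ seq y n) (+-cauchy {seq x} {seq y} (cauchy x) (cauchy y))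

_*_ : ℝ → ℝ → ℝ
x * y = mkℝ (λ n → seq x n ℚ.* seq y n) (*-cauchy {seq x} {seq y} (cauchy x) (cauchy y))

-- Collections of subsets of [N]: duplicate-free lists, identified when
-- they have the same members.

record Collection (N : ℕ) : Set where
  field
    members : List (Subset N)
    unique  : Unique members

open Collection public

size : ∀ {N} → Collection N → ℕ
size Φ = length (members Φ)

CollectionSetoid : ℕ → Setoid _ _
CollectionSetoid N = On.setoid ([ set ]-Equality (Subset N)) members

infix 4 _⊂_

_⊂_ : ∀ {N} → Collection N → Collection N → Set
Ψ ⊂ Φ = members Ψ List.⊆ members Φ × ¬ (members Φ List.⊆ members Ψ)

Minimal : ∀ {N} → (Collection N → Set) → Collection N → Set
Minimal P Φ = P Φ × (∀ Ψ → Ψ ⊂ Φ → ¬ P Ψ)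

-- The number of collections satisfying P is k.  Only the collection, not
-- the proof of P, matters for equality of elements.
Count : ∀ {N} → (Collection N → Set) → ℕ → Set
Count {N} P k =
  Inverse (On.setoid {B = Σ (Collection N) P} (CollectionSetoid N) proj₁) (≡.setoid (Fin k))

Count-functional : ∀ {N} {P : Collection N → Set} {k l} → Count P k → Count P l → k ≡ l
Count-functional p q = ↔⇒≡ (Compose.inverse (Symmetry.inverse p) q)

charVec : ∀ {N} → Subset N → Fin N → ℝ
charVec S i = if lookup S i then 1ℝ else 0ℝ

-- The i-th coordinate of the sum over S in Φ of w S times charVec S.
-- Only the values of w on members of Φ are used.
combination : ∀ {N} → Collection N → (Subset N → ℝ) → Fin N → ℝ
combination Φ w i = foldr _+_ 0ℝ (map (λ S → w S * charVec S i) (members Φ))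

Balanced : ∀ {N} → Collection N → Set
Balanced {N} Φ = ∃[ w ] (All (λ S → 0ℝ < w S) (members Φ)
                       × (∀ i → combination Φ w i ≃ 1ℝ))

MinimalBalanced : ∀ {N} → Collection N → Set
MinimalBalanced = Minimal Balanced

infix 4 B[_,_]=_ B[_]=_ κ[_,_]=_ κ[_]=_

B[_,_]=_ : ℕ → ℕ → ℕ → Set
B[ N , m ]= b = Count {N} (λ Φ → MinimalBalanced Φ × size Φ ≡ m) b

B[_]=_ : ℕ → ℕ → Set
B[ N ]= b = Count {N} MinimalBalanced b

LinearlyDependent : ∀ {n} → Collection n → Set
LinearlyDependent {n} Φ = ∃[ c ] (Any (λ S → ¬ (c S ≃ 0ℝ)) (members Φ)
                                × (∀ i → combination Φ c i ≃ 0ℝ))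

-- The normals of the resonance arrangement are the nonzero 0/1 vectors.
-- Since S ↦ charVec S is injective, a set of normals is given by a
-- collection of nonempty subsets.
Circuit : ∀ {n} → Collection n → Set
Circuit Φ = All Nonempty (members Φ) × Minimal LinearlyDependent Φ

κ[_,_]=_ : ℕ → ℕ → ℕ → Set
κ[ n , m ]= k = Count {n} (λ Φ → Circuit Φ × size Φ ≡ m) k

κ[_]=_ : ℕ → ℕ → Set
κ[ n ]= k = Count {n} Circuit k

{-# OPTIONS --safe #-}
-- Single out one element of [n+1] and replace every set of a minimal balanced
-- collection that contains it by its complement.  If A is the matrix of
-- characteristic vectors, w a weight on subsets of [n+1] and c T the weight of T
-- minus that of its complement, for T avoiding the extra element, then
--   (A w)(suc i) = (A w)(zero) + (A c)(i),
-- so balanced weights become linear relations on subsets of [n].  Unless the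
-- collection is {S, ∁ S} or {[n+1]}, of which there are 2^n, this yields a
-- circuit, and a circuit comes from exactly two collections, one for each sign
-- of its relation.  Real weights are first replaced by rational ones: a rational
-- generalised inverse of A corrects a close rational approximation to an exact
-- solution.
module Submission where

-- The counts have to be exhibited by explicit finite enumerations, whereas equality and order of
-- Cauchy reals cannot be decided; over ℚ both can. `Elementary` then gives minimal balanced
-- collections and circuits one common form: some admissible weight lives on the collection, and
-- every such weight is nonzero on all of it.
--
-- Two uniqueness facts carry the correspondence. A minimal balanced collection has no nonzero
-- relation, since otherwise its weight could be moved until a coordinate vanishes; so every v on it
-- with A v constant is a multiple of the balanced weight, and the reduced relation is unique up to
-- scale. Conversely, all relations on a circuit are proportional and vanish at none of its members,
-- so only two opposite sign patterns occur, and the sign at T decides which of the two sets with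
-- base T is taken. Both patterns give balanced collections: a nonzero relation between nonempty
-- sets has a negative entry, so the common value of the coordinates of the lifted weight is
-- positive and can be scaled to 1.

module Proof where
  open import Data.Bool as Bool using (Bool; true; false; not; if_then_else_)
  open import Data.Bool.Properties using (not-involutive; not-¬; ¬-not)
  open import Data.Empty using (⊥)
  open import Data.Fin as Fin using (Fin; zero; suc; splitAt; _↑ˡ_; _↑ʳ_; remQuot; combine)
  import Data.Fin.Properties as Fin
  open import Data.Fin.Subset as Subset using (Subset; Nonempty; ∁; inside; outside)
  open import Data.Fin.Subset.Properties using (nonempty?)
  open import Data.List as List using (List; []; _∷_; _++_; map; foldr; filter; deduplicate; length; allFin)
  import Data.List.Membership.DecPropositional
  open import Data.List.Membership.Propositional using (_∈_; _∉_; find; lose)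
  open import Data.List.Membership.Propositional.Properties using
    (∈-filter⁺; ∈-filter⁻; ∈-map⁺; ∈-map⁻; ∈-++⁺ˡ; ∈-++⁺ʳ; ∈-allFin; ∈-lookup)
  open import Data.List.Membership.Propositional.Properties.WithK using (unique∧set⇒bag)
  open import Data.List.Properties using (length-++; length-map)
  open import Data.List.Relation.Binary.BagAndSetEquality using (∼bag⇒↭)
  open import Data.List.Relation.Binary.Permutation.Propositional as ↭ using (_↭_)
  open import Data.List.Relation.Binary.Permutation.Propositional.Properties using (↭-length)
  open import Data.List.Relation.Binary.Subset.Propositional using (_⊆_)
  open import Data.List.Relation.Unary.All as All using (All; []; _∷_)
  import Data.List.Relation.Unary.All.Properties as All
  open import Data.List.Relation.Unary.AllPairs using (AllPairs; []; _∷_)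
  open import Data.List.Relation.Unary.Any using (Any; here; there; any?; index; satisfied)
  import Data.List.Relation.Unary.Any.Properties as Any
  import Data.List.Relation.Unary.Unique.DecSetoid.Properties as UniqueDec
  open import Data.List.Relation.Unary.Unique.Propositional using (Unique)
  import Data.List.Relation.Unary.Unique.Propositional.Properties as Unique
  open import Data.Nat as ℕ using (ℕ; zero; suc)
  import Data.Nat.Properties as ℕ
  open import Data.Product using (∃₂; ∃-syntax; _×_; _,_; proj₁; proj₂)
  open import Data.Rational hiding (_≃_)
  open import Data.Rational.Properties
  open import Data.Rational.Solver using (module +-*-Solver)
  open import Data.Sum using (_⊎_; inj₁; inj₂; [_,_]′)
  open import Data.Unit using (⊤; tt)
  open import Data.Vec as Vec using ([]; _∷_; lookup)
  open import Data.Vec.Properties using (map-∘; map-cong; map-id; lookup-map; lookup∘tabulate; ≡-dec; []=⇒lookup; lookup⇒[]=)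
  open import Defs hiding (_+_; _*_; _<_)
  open import Function using (_∘_; mk⇔)
  open import Function.Bundles using (module Equivalence; module Inverse)
  open import Level using (0ℓ)
  open import Relation.Binary.Bundles using (module Setoid; DecSetoid; DecTotalOrder)
  open import Relation.Binary.Definitions using (DecidableEquality; tri<; tri≈; tri>)
  open import Relation.Binary.PropositionalEquality using (_≡_; _≢_; refl; sym; trans; cong; cong₂; subst; module ≡-Reasoning)
  open import Relation.Nullary using (¬_; Dec; does; yes; no; contradiction; ¬?; _×-dec_)
  open import Relation.Nullary.Decidable using (dec-true; dec-false; decidable-stable; map′)
  open import Relation.Unary using (Pred; Decidable)
  open import Algebra.Properties.Group +-0-group using (⁻¹-involutive; ∙-cancelˡ)
  open import Data.List.Extrema (DecTotalOrder.totalOrder ≤-decTotalOrder) using (argmin; argmin-all; f[argmin]≤f[xs])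

  private
    variable
      A B     : Set
      n N k l : ℕ

  -- Finite sums of rationals

  ∑ : List A → (A → ℚ) → ℚ
  ∑ []       f = 0ℚ
  ∑ (x ∷ xs) f = f x + ∑ xs f

  ∑-cong : ∀ (xs : List A) {f g} → (∀ {x} → x ∈ xs → f x ≡ g x) → ∑ xs f ≡ ∑ xs g
  ∑-cong []       eq = refl
  ∑-cong (x ∷ xs) eq = cong₂ _+_ (eq (here refl)) (∑-cong xs (eq ∘ there))

  ∑-zero : ∀ (xs : List A) {f} → (∀ {x} → x ∈ xs → f x ≡ 0ℚ) → ∑ xs f ≡ 0ℚ
  ∑-zero []       eq = refl
  ∑-zero (x ∷ xs) eq = cong₂ _+_ (eq (here refl)) (∑-zero xs (eq ∘ there))

  ∑-+ : ∀ (xs : List A) f g → ∑ xs (λ x → f x + g x) ≡ ∑ xs f + ∑ xs g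
  ∑-+ []       f g = refl
  ∑-+ (x ∷ xs) f g = trans (cong (f x + g x +_) (∑-+ xs f g))
    (solve 4 (λ a b c d → (a :+ b) :+ (c :+ d) := (a :+ c) :+ (b :+ d)) refl (f x) (g x) (∑ xs f) (∑ xs g))
    where open +-*-Solver

  ∑-*ˡ : ∀ (xs : List A) a f → ∑ xs (λ x → a * f x) ≡ a * ∑ xs f
  ∑-*ˡ []       a f = sym (*-zeroʳ a)
  ∑-*ˡ (x ∷ xs) a f = trans (cong (a * f x +_) (∑-*ˡ xs a f)) (sym (*-distribˡ-+ a (f x) (∑ xs f)))

  ∑-*ʳ : ∀ (xs : List A) a f → ∑ xs (λ x → f x * a) ≡ ∑ xs f * a
  ∑-*ʳ xs a f = trans (∑-cong xs λ {x} _ → *-comm (f x) a) (trans (∑-*ˡ xs a f) (*-comm a (∑ xs f)))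

  ∑-++ : ∀ (xs ys : List A) f → ∑ (xs ++ ys) f ≡ ∑ xs f + ∑ ys f
  ∑-++ []       ys f = sym (+-identityˡ (∑ ys f))
  ∑-++ (x ∷ xs) ys f = trans (cong (f x +_) (∑-++ xs ys f)) (sym (+-assoc (f x) (∑ xs f) (∑ ys f)))

  ∑-map : ∀ (g : B → A) xs f → ∑ (map g xs) f ≡ ∑ xs (f ∘ g)
  ∑-map g []       f = refl
  ∑-map g (x ∷ xs) f = cong (f (g x) +_) (∑-map g xs f)

  ∑-swap : ∀ (xs : List A) (ys : List B) (f : A → B → ℚ) →
           ∑ xs (λ x → ∑ ys (f x)) ≡ ∑ ys (λ y → ∑ xs (λ x → f x y))
  ∑-swap []       ys f = sym (∑-zero ys λ _ → refl)
  ∑-swap (x ∷ xs) ys f = trans (cong (∑ ys (f x) +_) (∑-swap xs ys f)) (sym (∑-+ ys (f x) _))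

  ∑-single : ∀ {xs : List A} {x f} → Unique xs → x ∈ xs →
             (∀ {y} → y ∈ xs → y ≢ x → f y ≡ 0ℚ) → ∑ xs f ≡ f x
  ∑-single {xs = _ ∷ xs} {x} {f} (x∉xs ∷ _) (here refl) f≡0 =
    trans (cong (f x +_) (∑-zero xs λ y∈ → f≡0 (there y∈) (All.lookup x∉xs y∈ ∘ sym)))
            (+-identityʳ (f x))
  ∑-single {xs = _ ∷ xs} {x} {f} (x∉xs ∷ xs!) (there x∈) f≡0 =
    trans (cong₂ _+_ (f≡0 (here refl) (All.lookup x∉xs x∈)) (∑-single xs! x∈ (f≡0 ∘ there)))
            (+-identityˡ (f x))

  ∑-↭ : ∀ {xs ys : List A} f → xs ↭ ys → ∑ xs f ≡ ∑ ys f
  ∑-↭ f ↭.refl          = refl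
  ∑-↭ f (↭.prep x p)    = cong (f x +_) (∑-↭ f p)
  ∑-↭ {xs = _ ∷ _ ∷ xs} f (↭.swap x y p) = trans
    (solve 3 (λ a b c → a :+ (b :+ c) := b :+ (a :+ c)) refl (f x) (f y) (∑ xs f))
    (cong (λ z → f y + (f x + z)) (∑-↭ f p))
    where open +-*-Solver
  ∑-↭ f (↭.trans p q)   = trans (∑-↭ f p) (∑-↭ f q)

  ∑-filter : ∀ {P : Pred A 0ℓ} (P? : Decidable P) xs {f} →
             (∀ {x} → ¬ P x → f x ≡ 0ℚ) → ∑ (filter P? xs) f ≡ ∑ xs f
  ∑-filter P? []       f≡0 = refl
  ∑-filter P? (x ∷ xs) {f} f≡0 with P? x
  ... | yes _  = cong (f x +_) (∑-filter P? xs f≡0)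
  ... | no ¬Px = trans (∑-filter P? xs f≡0)
                   (trans (sym (+-identityˡ (∑ xs f))) (cong (_+ ∑ xs f) (sym (f≡0 ¬Px))))

  unique∧set⇒↭ : ∀ {xs ys : List A} → Unique xs → Unique ys → xs ⊆ ys → ys ⊆ xs → xs ↭ ys
  unique∧set⇒↭ xs! ys! xs⊆ys ys⊆xs = ∼bag⇒↭ (unique∧set⇒bag xs! ys! (mk⇔ xs⊆ys ys⊆xs))

  -- Keeping only those entries of `ys` that lie in `xs` gives a permutation of `xs`, and the
  -- discarded entries contribute zero. This is the passage between sums over a collection and sums
  -- over all subsets.
  ∑-support : DecidableEquality A → ∀ {xs ys : List A} {f} → Unique xs → Unique ys → xs ⊆ ys →
              (∀ {x} → x ∉ xs → f x ≡ 0ℚ) → ∑ xs f ≡ ∑ ys f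
  ∑-support _≟ᴬ_ {xs} {ys} {f} xs! ys! xs⊆ys f≡0 = trans
    (∑-↭ f (unique∧set⇒↭ xs! (Unique.filter⁺ (_∈? xs) ys!)
      (λ x∈ → ∈-filter⁺ (_∈? xs) (xs⊆ys x∈) x∈) (λ x∈ → proj₂ (∈-filter⁻ (_∈? xs) {xs = ys} x∈))))
    (∑-filter (_∈? xs) ys f≡0)
    where open import Data.List.Membership.DecPropositional _≟ᴬ_ using (_∈?_)

  ∑-nonNeg : ∀ (xs : List A) {f} → (∀ x → 0ℚ ≤ f x) → 0ℚ ≤ ∑ xs f
  ∑-nonNeg []       f≥0 = ≤-refl
  ∑-nonNeg (x ∷ xs) f≥0 = +-mono-≤ (f≥0 x) (∑-nonNeg xs f≥0)

  ∑-nonNeg-zero : ∀ (xs : List A) {f} → (∀ x → 0ℚ ≤ f x) → ∑ xs f ≡ 0ℚ →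
                  ∀ {x} → x ∈ xs → f x ≡ 0ℚ
  ∑-nonNeg-zero (y ∷ xs) {f} f≥0 eq = λ where
      (here refl) → fy≡0
      (there x∈)  → ∑-nonNeg-zero xs f≥0
        (trans (trans (sym (+-identityˡ _)) (cong (_+ ∑ xs f) (sym fy≡0))) eq) x∈
    where
    fy≡0 : f y ≡ 0ℚ
    fy≡0 = ≤-antisym
      (subst (f y ≤_) eq (≤-trans (≤-reflexive (sym (+-identityʳ (f y)))) (+-monoʳ-≤ (f y) (∑-nonNeg xs f≥0))))
      (f≥0 y)

  -- Generalised inverses over ℚ

  -- Total, with default 0, so that ratios of weights can be written at every subset before the
  -- denominators are known to be nonzero.
  recip : ℚ → ℚ
  recip q with q ≟ 0ℚ
  ... | yes _  = 0ℚ
  ... | no q≢0 = (1/ q) {{≢-nonZero q≢0}}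

  recip-inverse : ∀ {q} → q ≢ 0ℚ → recip q * q ≡ 1ℚ
  recip-inverse {q} q≢0 with q ≟ 0ℚ
  ... | yes q≡0 = contradiction q≡0 q≢0
  ... | no q≢0′ = *-inverseˡ q {{≢-nonZero q≢0′}}

  δ : {A : Set} → DecidableEquality A → A → A → ℚ
  δ _≟ᴬ_ x y = if does (x ≟ᴬ y) then 1ℚ else 0ℚ

  δ-≡ : {A : Set} (_≟ᴬ_ : DecidableEquality A) (x : A) → δ _≟ᴬ_ x x ≡ 1ℚ
  δ-≡ _≟ᴬ_ x = cong (if_then 1ℚ else 0ℚ) (dec-true (x ≟ᴬ x) refl)

  δ-≢ : {A : Set} (_≟ᴬ_ : DecidableEquality A) {x y : A} → x ≢ y → δ _≟ᴬ_ x y ≡ 0ℚ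
  δ-≢ _≟ᴬ_ {x} {y} x≢y = cong (if_then 1ℚ else 0ℚ) (dec-false (x ≟ᴬ y) x≢y)

  ∑-δ : {A : Set} (_≟ᴬ_ : DecidableEquality A) {xs : List A} {x : A} (f : A → ℚ) →
        Unique xs → x ∈ xs → ∑ xs (λ y → δ _≟ᴬ_ x y * f y) ≡ f x
  ∑-δ _≟ᴬ_ {x = x} f xs! x∈ = trans
    (∑-single xs! x∈ λ {y} _ y≢x → trans (cong (_* f y) (δ-≢ _≟ᴬ_ (y≢x ∘ sym))) (*-zeroˡ (f y)))
    (trans (cong (_* f x) (δ-≡ _≟ᴬ_ x)) (*-identityˡ (f x)))

  infix 8 _∙_

  _∙_ : ∀ {N} → (Fin N → ℚ) → (Fin N → ℚ) → ℚ
  _∙_ {N} u x = ∑ (allFin N) λ i → u i * x i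

  module _ {N : ℕ} where

    ∙-minusˡ : ∀ (u v x : Fin N → ℚ) → (λ i → u i - v i) ∙ x ≡ u ∙ x - v ∙ x
    ∙-minusˡ u v x = begin
      (λ i → u i - v i) ∙ x                                   ≡⟨ ∑-cong (allFin N) (λ {i} _ → expand (u i) (v i) (x i)) ⟩
      ∑ (allFin N) (λ i → u i * x i + (- 1ℚ) * (v i * x i))   ≡⟨ ∑-+ (allFin N) _ _ ⟩
      u ∙ x + ∑ (allFin N) (λ i → (- 1ℚ) * (v i * x i))       ≡⟨ cong (u ∙ x +_) (∑-*ˡ (allFin N) (- 1ℚ) _) ⟩
      u ∙ x + (- 1ℚ) * v ∙ x                                  ≡⟨ collect (u ∙ x) (v ∙ x) ⟩
      u ∙ x - v ∙ x                                           ∎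
      where
      open ≡-Reasoning
      open +-*-Solver
      expand : ∀ a b c → (a - b) * c ≡ a * c + (- 1ℚ) * (b * c)
      expand = solve 3 (λ a b c → (a :- b) :* c := a :* c :+ (:- con 1ℚ) :* (b :* c)) refl
      collect : ∀ a b → a + (- 1ℚ) * b ≡ a - b
      collect = solve 2 (λ a b → a :+ (:- con 1ℚ) :* b := a :- b) refl

    ∙-* : ∀ a (u x : Fin N → ℚ) → (λ i → a * u i) ∙ x ≡ a * u ∙ x
    ∙-* a u x = trans (∑-cong (allFin N) (λ {i} _ → *-assoc a (u i) (x i))) (∑-*ˡ (allFin N) a _)

    ∑-∙ : ∀ {A : Set} (xs : List A) (u : A → Fin N → ℚ) x →
          (λ i → ∑ xs (λ y → u y i)) ∙ x ≡ ∑ xs (λ y → u y ∙ x)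
    ∑-∙ xs u x = trans (∑-cong (allFin N) (λ {i} _ → sym (∑-*ʳ xs (x i) _))) (∑-swap (allFin N) xs _)

    ∙-∑ : ∀ {A : Set} (xs : List A) (u : Fin N → ℚ) (a : A → ℚ) (x : A → Fin N → ℚ) →
          u ∙ (λ i → ∑ xs (λ y → a y * x y i)) ≡ ∑ xs (λ y → a y * u ∙ x y)
    ∙-∑ xs u a x = begin
      ∑ (allFin N) (λ i → u i * ∑ xs (λ y → a y * x y i))    ≡⟨ ∑-cong (allFin N) (λ {i} _ → ∑-*ˡ xs (u i) _) ⟨
      ∑ (allFin N) (λ i → ∑ xs (λ y → u i * (a y * x y i)))  ≡⟨ ∑-swap (allFin N) xs _ ⟩
      ∑ xs (λ y → ∑ (allFin N) (λ i → u i * (a y * x y i)))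
        ≡⟨ ∑-cong xs (λ {y} _ → ∑-cong (allFin N) λ {i} _ → exchange (u i) (a y) (x y i)) ⟩
      ∑ xs (λ y → ∑ (allFin N) (λ i → a y * (u i * x y i)))  ≡⟨ ∑-cong xs (λ {y} _ → ∑-*ˡ (allFin N) (a y) _) ⟩
      ∑ xs (λ y → a y * u ∙ x y)                             ∎
      where
      open ≡-Reasoning
      open +-*-Solver
      exchange : ∀ a b c → a * (b * c) ≡ b * (a * c)
      exchange = solve 3 (λ a b c → a :* (b :* c) := b :* (a :* c)) refl

    ∙-comm : ∀ (u x : Fin N → ℚ) → u ∙ x ≡ x ∙ u
    ∙-comm u x = ∑-cong (allFin N) λ {i} _ → *-comm (u i) (x i)

    coordinate : Fin N → Fin N → ℚ
    coordinate = δ Fin._≟_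

    coordinate-∙ : ∀ p (x : Fin N → ℚ) → coordinate p ∙ x ≡ x p
    coordinate-∙ p x = ∑-δ Fin._≟_ x (Unique.allFin⁺ N) (∈-allFin p)

  module _ {K : Set} (_≟ᴷ_ : DecidableEquality K) {N : ℕ} (v : K → Fin N → ℚ) where

    project : List K → (K → Fin N → ℚ) → (Fin N → ℚ) → Fin N → ℚ
    project ks u x i = ∑ ks λ j → u j ∙ x * v j i

    -- With A the matrix whose columns are v k for k in ks and L the matrix whose
    -- rows are u k, this says A L A = A.
    IsGInverse : List K → (K → Fin N → ℚ) → Set
    IsGInverse ks u = ∀ {k} → k ∈ ks → ∀ i → project ks u (v k) i ≡ v k i

    project-minus : ∀ ks u x y i → project ks u (λ i → x i - y i) i ≡ project ks u x i - project ks u y i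
    project-minus ks u x y i = begin
      ∑ ks (λ j → u j ∙ (λ i → x i - y i) * v j i)
        ≡⟨ ∑-cong ks (λ {j} _ → trans (cong (_* v j i) (trans (∙-comm (u j) _) (trans (∙-minusˡ x y (u j))
             (cong₂ _-_ (∙-comm x (u j)) (∙-comm y (u j)))))) (expand (u j ∙ x) (u j ∙ y) (v j i))) ⟩
      ∑ ks (λ j → u j ∙ x * v j i + (- 1ℚ) * (u j ∙ y * v j i))
        ≡⟨ trans (∑-+ ks _ _) (cong (project ks u x i +_) (∑-*ˡ ks (- 1ℚ) _)) ⟩
      project ks u x i + (- 1ℚ) * project ks u y i
        ≡⟨ collect (project ks u x i) (project ks u y i) ⟩
      project ks u x i - project ks u y i ∎
      where
      open ≡-Reasoning
      open +-*-Solver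
      expand : ∀ a b c → (a - b) * c ≡ a * c + (- 1ℚ) * (b * c)
      expand = solve 3 (λ a b c → (a :- b) :* c := a :* c :+ (:- con 1ℚ) :* (b :* c)) refl
      collect : ∀ a b → a + (- 1ℚ) * b ≡ a - b
      collect = solve 2 (λ a b → a :+ (:- con 1ℚ) :* b := a :- b) refl

    -- By A L A = A, the map A L fixes every A a. An approximate solution thus stays put under A L,
    -- and only its error is affected.
    project-span : ∀ {ks u} → IsGInverse ks u → ∀ (a : K → ℚ) i →
      project ks u (λ i → ∑ ks (λ k → a k * v k i)) i ≡ ∑ ks (λ k → a k * v k i)
    project-span {ks} {u} inv a i = begin
      ∑ ks (λ j → u j ∙ (λ i → ∑ ks (λ k → a k * v k i)) * v j i)
        ≡⟨ ∑-cong ks (λ {j} _ → trans (cong (_* v j i) (∙-∑ ks (u j) a v)) (sym (∑-*ʳ ks (v j i) _))) ⟩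
      ∑ ks (λ j → ∑ ks (λ k → a k * u j ∙ v k * v j i))
        ≡⟨ ∑-swap ks ks _ ⟩
      ∑ ks (λ k → ∑ ks (λ j → a k * u j ∙ v k * v j i))
        ≡⟨ ∑-cong ks (λ {k} k∈ → trans (∑-cong ks λ {j} _ → *-assoc (a k) (u j ∙ v k) (v j i))
             (trans (∑-*ˡ ks (a k) _) (cong (a k *_) (inv k∈ i)))) ⟩
      ∑ ks (λ k → a k * v k i) ∎
      where open ≡-Reasoning

    private
      -- A functional vanishing on the span of ks and, unless v k₀ lies in that
      -- span, taking the value 1 at v k₀.
      separate : ∀ ks u k₀ → IsGInverse ks u → ∃[ φ ] ((∀ {k} → k ∈ ks → φ ∙ v k ≡ 0ℚ) ×
        (∀ i → φ ∙ v k₀ * (v k₀ i - project ks u (v k₀) i) ≡ v k₀ i - project ks u (v k₀) i))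
      separate ks u k₀ inv with Fin.all? (λ i → (v k₀ i - project ks u (v k₀) i) ≟ 0ℚ)
      -- Here `v k₀` already lies in the span. The second condition is stated as a product with the
      -- residual, so the zero functional satisfies it.
      ... | yes r≡0 = (λ _ → 0ℚ) , (λ {k} _ → ∑-zero (allFin N) λ {i} _ → *-zeroˡ (v k i)) ,
        λ i → trans (cong (((λ _ → 0ℚ) ∙ v k₀) *_) (r≡0 i)) (trans (*-zeroʳ ((λ _ → 0ℚ) ∙ v k₀)) (sym (r≡0 i)))
      ... | no r≢0 with p , rp≢0 ← Fin.¬∀⟶∃¬ N _ (λ i → (v k₀ i - project ks u (v k₀) i) ≟ 0ℚ) r≢0
        = φ
        , (λ {k} k∈ → trans (φ-∙ (v k)) (trans (cong (λ z → s * (v k p - z)) (inv k∈ p))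
                        (trans (cong (s *_) (+-inverseʳ (v k p))) (*-zeroʳ s))))
        , (λ i → trans (cong (_* _) (trans (φ-∙ (v k₀)) (recip-inverse rp≢0))) (*-identityˡ _))
        where
        -- `φ` is the p-th row of I - A L, which kills the old columns by A L A = A. Its value at
        -- `v k₀` is the p-th entry of the residual, nonzero by the choice of `p`, and `s` scales
        -- this value to 1.
        s : ℚ
        s = recip (v k₀ p - project ks u (v k₀) p)
        φ : Fin N → ℚ
        φ i = s * (coordinate p i - ∑ ks (λ j → v j p * u j i))
        φ-∙ : ∀ x → φ ∙ x ≡ s * (x p - project ks u x p)
        φ-∙ x = trans (∙-* s _ x) (cong (s *_) (trans (∙-minusˡ (coordinate p) _ x)
          (cong₂ _-_ (coordinate-∙ p x) (trans (∑-∙ ks _ x)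
            (∑-cong ks λ {j} _ → trans (∙-* (v j p) (u j) x) (*-comm (v j p) (u j ∙ x)))))))

    -- Columns are added one at a time. The new row is `φ`, and each old row loses a multiple of
    -- `φ`, so that A L changes by the rank-one term of `project′`: `φ ∙ x` times the residual of
    -- `v k₀`. This term vanishes at the old columns and supplies exactly what is missing at `v k₀`.
    gInverse : ∀ {ks} → Unique ks → ∃[ u ] IsGInverse ks u
    gInverse {[]}      _ = (λ _ _ → 0ℚ) , λ ()
    gInverse {k₀ ∷ ks} (k₀∉ks ∷ ks!)
      with u , inv ← gInverse ks!
      with φ , φ-ks , φ-k₀ ← separate ks u k₀ inv = u′ , inv′
      where
      u′ : K → Fin N → ℚ
      u′ j i = if does (k₀ ≟ᴷ j) then φ i else u j i - u j ∙ v k₀ * φ i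
      u′-k₀ : ∀ x → u′ k₀ ∙ x ≡ φ ∙ x
      u′-k₀ x rewrite dec-true (k₀ ≟ᴷ k₀) refl = refl
      u′-ks : ∀ {j} x → j ∈ ks → u′ j ∙ x ≡ u j ∙ x - u j ∙ v k₀ * φ ∙ x
      u′-ks {j} x j∈ rewrite dec-false (k₀ ≟ᴷ j) (All.lookup k₀∉ks j∈) =
        trans (∙-minusˡ (u j) _ x) (cong (λ z → u j ∙ x - z) (∙-* (u j ∙ v k₀) φ x))
      project′ : ∀ x i → project (k₀ ∷ ks) u′ x i ≡
        φ ∙ x * (v k₀ i - project ks u (v k₀) i) + project ks u x i
      project′ x i = begin
        u′ k₀ ∙ x * v k₀ i + ∑ ks (λ j → u′ j ∙ x * v j i)
          ≡⟨ cong₂ _+_ (cong (_* v k₀ i) (u′-k₀ x)) (∑-cong ks λ {j} j∈ →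
               trans (cong (_* v j i) (u′-ks x j∈)) (expand (u j ∙ x) (u j ∙ v k₀) (φ ∙ x) (v j i))) ⟩
        φ ∙ x * v k₀ i + ∑ ks (λ j → u j ∙ x * v j i + (- (φ ∙ x)) * (u j ∙ v k₀ * v j i))
          ≡⟨ cong (φ ∙ x * v k₀ i +_) (trans (∑-+ ks _ _) (cong (project ks u x i +_) (∑-*ˡ ks (- (φ ∙ x)) _))) ⟩
        φ ∙ x * v k₀ i + (project ks u x i + (- (φ ∙ x)) * project ks u (v k₀) i)
          ≡⟨ collect (φ ∙ x) (v k₀ i) (project ks u x i) (project ks u (v k₀) i) ⟩
        φ ∙ x * (v k₀ i - project ks u (v k₀) i) + project ks u x i ∎
        where
        open ≡-Reasoning
        open +-*-Solver
        expand : ∀ a b c d → (a - b * c) * d ≡ a * d + (- c) * (b * d)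
        expand = solve 4 (λ a b c d → (a :- b :* c) :* d := a :* d :+ (:- c) :* (b :* d)) refl
        collect : ∀ a b c d → a * b + (c + (- a) * d) ≡ a * (b - d) + c
        collect = solve 4 (λ a b c d → a :* b :+ (c :+ (:- a) :* d) := a :* (b :- d) :+ c) refl
      inv′ : IsGInverse (k₀ ∷ ks) u′
      inv′ (here refl) i = trans (project′ (v k₀) i) (trans (cong (_+ _) (φ-k₀ i))
        (cancel (v k₀ i) (project ks u (v k₀) i)))
        where
        open +-*-Solver
        cancel : ∀ a b → a - b + b ≡ a
        cancel = solve 2 (λ a b → a :- b :+ b := a) refl
      inv′ {k} (there k∈) i = trans (project′ (v k) i)
        (trans (cong₂ _+_ (trans (cong (_* r) (φ-ks k∈)) (*-zeroˡ r)) (inv k∈ i)) (+-identityˡ (v k i)))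
        where r = v k₀ i - project ks u (v k₀) i

  -- Subsets of [n+1] as signed subsets of [n]

  _≟ˢ_ : DecidableEquality (Subset n)
  _≟ˢ_ = ≡-dec Bool._≟_

  ∁-involutive : (S : Subset n) → ∁ (∁ S) ≡ S
  ∁-involutive S = trans (sym (map-∘ not not S)) (trans (map-cong not-involutive S) (map-id S))

  -- S ↔ (side S , base S) identifies a subset of [n+1] with the side on which
  -- the extra element lies and, of S and its complement, the one avoiding it.
  side : Subset (suc n) → Bool
  side = Vec.head

  base : Subset (suc n) → Subset n
  base (false ∷ S) = S
  base (true  ∷ S) = ∁ S

  lift : Bool → Subset n → Subset (suc n)
  lift false T = outside ∷ T
  lift true  T = inside ∷ ∁ T

  side-lift : ∀ b (T : Subset n) → side (lift b T) ≡ b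
  side-lift false T = refl
  side-lift true  T = refl

  base-lift : ∀ b (T : Subset n) → base (lift b T) ≡ T
  base-lift false T = refl
  base-lift true  T = ∁-involutive T

  lift-side-base : (S : Subset (suc n)) → lift (side S) (base S) ≡ S
  lift-side-base (false ∷ S) = refl
  lift-side-base (true  ∷ S) = cong (inside ∷_) (∁-involutive S)

  lift-injective : ∀ b {T U : Subset n} → lift b T ≡ lift b U → T ≡ U
  lift-injective b {T} {U} eq = trans (sym (base-lift b T)) (trans (cong base eq) (base-lift b U))

  -- The second half is listed through `lift true`, hence by complements, so that `∑-lift` runs over
  -- the two sets with the same base in parallel.
  subsets : ∀ n → List (Subset n)
  subsets zero    = [] ∷ []
  subsets (suc n) = map (lift false) (subsets n) ++ map (lift true) (subsets n)

  ∈-subsets : (S : Subset n) → S ∈ subsets n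
  ∈-subsets []          = here refl
  ∈-subsets {suc n} S = subst (_∈ subsets (suc n)) (lift-side-base S) (lifted (side S) (∈-subsets (base S)))
    where
    lifted : ∀ b {T} → T ∈ subsets n → lift b T ∈ subsets (suc n)
    lifted false T∈ = ∈-++⁺ˡ (∈-map⁺ (lift false) T∈)
    lifted true  T∈ = ∈-++⁺ʳ (map (lift false) (subsets n)) (∈-map⁺ (lift true) T∈)

  subsets-unique : ∀ n → Unique (subsets n)
  subsets-unique zero    = [] ∷ []
  subsets-unique (suc n) = Unique.++⁺
    (Unique.map⁺ (lift-injective false) (subsets-unique n))
    (Unique.map⁺ (lift-injective true) (subsets-unique n))
    λ (S∈ , S∈′) → disjoint (∈-map⁻ (lift false) S∈) (∈-map⁻ (lift true) S∈′)
    where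
    disjoint : ∀ {S} → ∃[ T ] T ∈ subsets n × S ≡ lift false T →
      ∃[ T ] T ∈ subsets n × S ≡ lift true T → ⊥
    disjoint (_ , _ , refl) (_ , _ , ())

  length-subsets : ∀ n → length (subsets n) ≡ 2 ℕ.^ n
  length-subsets zero    = refl
  length-subsets (suc n) = begin
    length (map (lift false) (subsets n) ++ map (lift true) (subsets n))             ≡⟨ length-++ (map (lift false) (subsets n)) ⟩
    length (map (lift false) (subsets n)) ℕ.+ length (map (lift true) (subsets n))  ≡⟨ cong₂ ℕ._+_ (count false) (count true) ⟩
    2 ℕ.^ n ℕ.+ 2 ℕ.^ n                                                             ≡⟨ cong (2 ℕ.^ n ℕ.+_) (ℕ.+-identityʳ (2 ℕ.^ n)) ⟨
    2 ℕ.^ suc n                                                                      ∎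
    where
    open ≡-Reasoning
    count : ∀ b → length (map (lift b) (subsets n)) ≡ 2 ℕ.^ n
    count b = trans (length-map (lift b) (subsets n)) (length-subsets n)

  -- Weights on all subsets, and their reduction from [n+1] to [n]

  Weight : ℕ → Set
  Weight N = Subset N → ℚ

  χ : Subset n → Fin n → ℚ
  χ S i = if lookup S i then 1ℚ else 0ℚ

  χ-nonNeg : ∀ (S : Subset n) i → 0ℚ ≤ χ S i
  χ-nonNeg S i with lookup S i
  ... | true  = nonNegative⁻¹ 1ℚ
  ... | false = ≤-refl

  χ-∁ : ∀ (S : Subset n) i → χ (∁ S) i ≡ 1ℚ - χ S i
  χ-∁ S i rewrite lookup-map i not S with lookup S i
  ... | true  = refl
  ... | false = refl

  -- The columns of A are all subsets, not just the members of one collection. Weights on different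
  -- collections can then be added and compared, while `SupportedOn` keeps track of where they live.
  total : Weight n → Fin n → ℚ
  total {n} w i = ∑ (subsets n) λ S → w S * χ S i

  Relation : Weight n → Set
  Relation c = ∀ i → total c i ≡ 0ℚ

  BalancedWeight : Weight n → Set
  BalancedWeight w = (∀ S → 0ℚ ≤ w S) × (∀ i → total w i ≡ 1ℚ)

  total-cong : ∀ {v w : Weight n} → (∀ S → v S ≡ w S) → ∀ i → total v i ≡ total w i
  total-cong {n} eq i = ∑-cong (subsets n) λ {S} _ → cong (_* χ S i) (eq S)

  total-linear : ∀ a b (v w : Weight n) i → total (λ S → a * v S + b * w S) i ≡ a * total v i + b * total w i
  total-linear {n} a b v w i = begin
    ∑ (subsets n) (λ S → (a * v S + b * w S) * χ S i)              ≡⟨ ∑-cong (subsets n) (λ {S} _ → expand a b (v S) (w S) (χ S i)) ⟩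
    ∑ (subsets n) (λ S → a * (v S * χ S i) + b * (w S * χ S i))    ≡⟨ ∑-+ (subsets n) _ _ ⟩
    ∑ (subsets n) (λ S → a * (v S * χ S i)) + ∑ (subsets n) (λ S → b * (w S * χ S i))
      ≡⟨ cong₂ _+_ (∑-*ˡ (subsets n) a _) (∑-*ˡ (subsets n) b _) ⟩
    a * total v i + b * total w i                                  ∎
    where
    open ≡-Reasoning
    open +-*-Solver
    expand : ∀ a b c d e → (a * c + b * d) * e ≡ a * (c * e) + b * (d * e)
    expand = solve 5 (λ a b c d e → (a :* c :+ b :* d) :* e := a :* (c :* e) :+ b :* (d :* e)) refl

  ∑-lift : ∀ (f : Subset (suc n) → ℚ) →
    ∑ (subsets (suc n)) f ≡ ∑ (subsets n) (λ T → f (lift false T)) + ∑ (subsets n) (λ T → f (lift true T))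
  ∑-lift {n} f = trans (∑-++ (map (lift false) (subsets n)) _ f)
    (cong₂ _+_ (∑-map (lift false) (subsets n) f) (∑-map (lift true) (subsets n) f))

  reduce : Weight (suc n) → Weight n
  reduce w T = w (lift false T) - w (lift true T)

  total-zero : (w : Weight (suc n)) → total w zero ≡ ∑ (subsets n) (λ T → w (lift true T))
  total-zero {n} w = begin
    total w zero   ≡⟨ ∑-lift (λ S → w S * χ S zero) ⟩
    ∑ (subsets n) (λ T → w (lift false T) * 0ℚ) + ∑ (subsets n) (λ T → w (lift true T) * 1ℚ)
      ≡⟨ cong₂ _+_ (∑-zero (subsets n) (λ {T} _ → *-zeroʳ (w (lift false T))))
                   (∑-cong (subsets n) (λ {T} _ → *-identityʳ (w (lift true T)))) ⟩
    0ℚ + ∑ (subsets n) (λ T → w (lift true T)) ≡⟨ +-identityˡ _ ⟩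
    ∑ (subsets n) (λ T → w (lift true T)) ∎
    where open ≡-Reasoning

  -- A set containing the extra element is the complement of its base on [n] and contributes
  -- `1 - χ T i`. The ones add up to `total w zero` by `total-zero`; what remains carries the
  -- coefficient `reduce w T`.
  total-suc : ∀ (w : Weight (suc n)) i → total w (suc i) ≡ total w zero + total (reduce w) i
  total-suc {n} w i = begin
    total w (suc i)
      ≡⟨ ∑-lift (λ S → w S * χ S (suc i)) ⟩
    ∑ (subsets n) (λ T → w (lift false T) * χ T i) + ∑ (subsets n) (λ T → w (lift true T) * χ (∁ T) i)
      ≡⟨ ∑-+ (subsets n) _ _ ⟨
    ∑ (subsets n) (λ T → w (lift false T) * χ T i + w (lift true T) * χ (∁ T) i)
      ≡⟨ ∑-cong (subsets n) (λ {T} _ → trans (cong (λ z → w (lift false T) * χ T i + w (lift true T) * z) (χ-∁ T i))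
           (expand (w (lift false T)) (w (lift true T)) (χ T i))) ⟩
    ∑ (subsets n) (λ T → w (lift true T) + reduce w T * χ T i)
      ≡⟨ ∑-+ (subsets n) _ _ ⟩
    ∑ (subsets n) (λ T → w (lift true T)) + total (reduce w) i
      ≡⟨ cong (_+ total (reduce w) i) (total-zero w) ⟨
    total w zero + total (reduce w) i ∎
    where
    open ≡-Reasoning
    open +-*-Solver
    expand : ∀ a b c → a * c + b * (1ℚ - c) ≡ b + (a - b) * c
    expand = solve 3 (λ a b c → a :* c :+ b :* (con 1ℚ :- c) := b :+ (a :- b) :* c) refl

  -- From real to rational weights

  Eventually : (ℕ → Set) → Set
  Eventually P = ∃[ k ] (∀ n → k ℕ.≤ n → P n)

  Eventually-map : ∀ {P Q : ℕ → Set} → (∀ {n} → P n → Q n) → Eventually P → Eventually Q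
  Eventually-map f (k , h) = k , λ n kn → f (h n kn)

  Eventually-× : ∀ {P Q : ℕ → Set} → Eventually P → Eventually Q → Eventually (λ n → P n × Q n)
  Eventually-× (k , h) (l , g) = k ℕ.⊔ l , λ n kn →
    h n (ℕ.m⊔n≤o⇒m≤o k l kn) , g n (ℕ.m⊔n≤o⇒n≤o k l kn)

  Eventually-All : ∀ {A : Set} {P : A → ℕ → Set} {xs} →
    All (λ x → Eventually (P x)) xs → Eventually (λ n → All (λ x → P x n) xs)
  Eventually-All []         = 0 , λ _ _ → []
  Eventually-All (px ∷ pxs) = Eventually-map (λ (p , ps) → p ∷ ps) (Eventually-× px (Eventually-All pxs))

  ≤∧≢⇒< : ∀ {p q} → p ≤ q → p ≢ q → p < q
  ≤∧≢⇒< {p} {q} p≤q p≢q with <-cmp p q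
  ... | tri< p<q _ _ = p<q
  ... | tri≈ _ p≡q _ = contradiction p≡q p≢q
  ... | tri> _ _ q<p = contradiction (≤-antisym p≤q (<⇒≤ q<p)) p≢q

  -∣p∣≤p : ∀ p → - ∣ p ∣ ≤ p
  -∣p∣≤p p with ≤-total 0ℚ p
  ... | inj₁ 0≤p = ≤-trans (neg-antimono-≤ (0≤∣p∣ p)) 0≤p
  ... | inj₂ p≤0 = ≤-reflexive (trans (cong -_ (trans (sym (∣-p∣≡∣p∣ p)) (0≤p⇒∣p∣≡p (neg-antimono-≤ p≤0)))) (⁻¹-involutive p))

  0<½ : 0ℚ < ½
  0<½ = positive⁻¹ ½

  0<* : ∀ {p q} → 0ℚ < p → 0ℚ < q → 0ℚ < p * q
  0<* {p} {q} 0<p 0<q = positive⁻¹ (p * q)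
    where instance
      p⁺  = positive 0<p
      q⁺  = positive 0<q
      pq⁺ = pos*pos⇒pos p q

  ½+½ : ∀ ε → ½ * ε + ½ * ε ≡ ε
  ½+½ ε = trans (sym (*-distribʳ-+ ε ½ ½)) (*-identityˡ ε)

  ½*<  : ∀ {ε} → 0ℚ < ε → ½ * ε < ε
  ½*< {ε} 0<ε = begin-strict
    ½ * ε             ≡⟨ +-identityˡ (½ * ε) ⟨
    0ℚ + ½ * ε        <⟨ +-monoˡ-< (½ * ε) (0<* 0<½ 0<ε) ⟩
    ½ * ε + ½ * ε     ≡⟨ ½+½ ε ⟩
    ε                 ∎
    where open ≤-Reasoning

  -- Convergence to zero. `x ≃ y` unfolds to `Null` of the termwise difference, so hypotheses on
  -- real sums are used here without conversion.
  Null : (ℕ → ℚ) → Set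
  Null x = ∀ ε → 0ℚ < ε → Eventually (λ n → ∣ x n ∣ < ε)

  Null-cong : ∀ {x y : ℕ → ℚ} → (∀ n → x n ≡ y n) → Null x → Null y
  Null-cong eq x→0 ε 0<ε = Eventually-map (λ {n} → subst (λ q → ∣ q ∣ < ε) (eq n)) (x→0 ε 0<ε)

  Null-0 : Null (λ _ → 0ℚ)
  Null-0 ε 0<ε = 0 , λ _ _ → 0<ε

  Null-+ : ∀ {x y : ℕ → ℚ} → Null x → Null y → Null (λ n → x n + y n)
  Null-+ {x} {y} x→0 y→0 ε 0<ε =
    Eventually-map (λ {n} (hx , hy) → ≤-<-trans (∣p+q∣≤∣p∣+∣q∣ (x n) (y n))
                      (<-≤-trans (+-mono-< hx hy) (≤-reflexive (½+½ ε))))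
      (Eventually-× (x→0 (½ * ε) (0<* 0<½ 0<ε)) (y→0 (½ * ε) (0<* 0<½ 0<ε)))

  Null-* : ∀ a {x : ℕ → ℚ} → Null x → Null (λ n → a * x n)
  Null-* a {x} x→0 ε 0<ε = Eventually-map bound (x→0 (r * ε) (0<* 0<r 0<ε))
    where
    b = ∣ a ∣ + 1ℚ
    0<b : 0ℚ < b
    0<b = +-mono-≤-< (0≤∣p∣ a) (positive⁻¹ 1ℚ)
    instance
      b⁺ = positive 0<b
      b≢0 = pos⇒nonZero b
    r = 1/ b
    0<r : 0ℚ < r
    0<r = positive⁻¹ r {{1/pos⇒pos b}}
    ∣a∣≤b : ∣ a ∣ ≤ b
    ∣a∣≤b = ≤-trans (≤-reflexive (sym (+-identityʳ ∣ a ∣))) (+-monoʳ-≤ ∣ a ∣ (nonNegative⁻¹ 1ℚ))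
    bound : ∀ {n} → ∣ x n ∣ < r * ε → ∣ a * x n ∣ < ε
    bound {n} h = begin-strict
      ∣ a * x n ∣       ≡⟨ ∣p*q∣≡∣p∣*∣q∣ a (x n) ⟩
      ∣ a ∣ * ∣ x n ∣   ≤⟨ *-monoʳ-≤-nonNeg ∣ x n ∣ {{nonNegative (0≤∣p∣ (x n))}} ∣a∣≤b ⟩
      b * ∣ x n ∣       <⟨ *-monoʳ-<-pos b h ⟩
      b * (r * ε)       ≡⟨ *-assoc b r ε ⟨
      b * r * ε         ≡⟨ cong (_* ε) (*-inverseʳ b) ⟩
      1ℚ * ε            ≡⟨ *-identityˡ ε ⟩
      ε                 ∎
      where open ≤-Reasoning

  Null-∑ : ∀ {A : Set} (xs : List A) (a : A → ℚ) {x : A → ℕ → ℚ} → (∀ y → Null (x y)) →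
           Null (λ n → ∑ xs λ y → a y * x y n)
  Null-∑ []       a x→0 = Null-0
  Null-∑ (y ∷ xs) a x→0 = Null-+ (Null-* (a y) (x→0 y)) (Null-∑ xs a x→0)

  -- If `q` were nonzero, ε = ∣ q ∣ would give ∣ q ∣ < ∣ q ∣. This turns a limit statement into an
  -- exact rational equation.
  Null-const : ∀ {q} → Null (λ _ → q) → q ≡ 0ℚ
  Null-const {q} q→0 = decidable-stable (q ≟ 0ℚ) λ q≢0 →
    let k , h = q→0 ∣ q ∣ (≤∧≢⇒< (0≤∣p∣ q) λ eq → q≢0 (∣p∣≡0⇒p≡0 q (sym eq)))
    in <-irrefl refl (h k ℕ.≤-refl)

  Null-∙ : ∀ (u : Fin N → ℚ) {x : ℕ → Fin N → ℚ} → (∀ i → Null (λ n → x n i)) → Null (λ n → u ∙ x n)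
  Null-∙ {N} u = Null-∑ (allFin N) u

  seq-combination : ∀ (Φ : Collection N) w i n →
    seq (combination Φ w i) n ≡ ∑ (members Φ) (λ S → seq (w S) n * χ S i)
  seq-combination Φ w i n = go (members Φ)
    where
    seq-charVec : ∀ S → seq (charVec S i) n ≡ χ S i
    seq-charVec S with lookup S i
    ... | true  = refl
    ... | false = refl
    go : ∀ Ss → seq (foldr Defs._+_ 0ℝ (map (λ S → w S Defs.* charVec S i) Ss)) n
              ≡ ∑ Ss (λ S → seq (w S) n * χ S i)
    go []       = refl
    go (S ∷ Ss) = cong₂ _+_ (cong (seq (w S) n *_) (seq-charVec S)) (go Ss)

  _∈?_ : ∀ (S : Subset N) Ss → Dec (S ∈ Ss)
  _∈?_ = Data.List.Membership.DecPropositional._∈?_ _≟ˢ_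

  SupportedOn : Weight N → Collection N → Set
  SupportedOn w Φ = ∀ {S} → w S ≢ 0ℚ → S ∈ members Φ

  vanishes : ∀ {w : Weight N} {Φ} → SupportedOn w Φ → ∀ {S} → S ∉ members Φ → w S ≡ 0ℚ
  vanishes {w = w} w⊆Φ {S} S∉ = decidable-stable (w S ≟ 0ℚ) (S∉ ∘ w⊆Φ)

  restrict : Collection N → Weight N → Weight N
  restrict Φ w S = if does (S ∈? members Φ) then w S else 0ℚ

  restrict-∈ : ∀ Φ (w : Weight N) {S} → S ∈ members Φ → restrict Φ w S ≡ w S
  restrict-∈ Φ w {S} S∈ = cong (if_then w S else 0ℚ) (dec-true (S ∈? members Φ) S∈)

  restrict-∉ : ∀ Φ (w : Weight N) {S} → S ∉ members Φ → restrict Φ w S ≡ 0ℚ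
  restrict-∉ Φ w {S} S∉ = cong (if_then w S else 0ℚ) (dec-false (S ∈? members Φ) S∉)

  restrict-supported : ∀ Φ (w : Weight N) → SupportedOn (restrict Φ w) Φ
  restrict-supported Φ w {S} w≢0 with S ∈? members Φ
  ... | yes S∈ = S∈
  ... | no S∉  = contradiction refl w≢0

  restrict-nonNeg : ∀ Φ (w : Weight N) → (∀ {S} → S ∈ members Φ → 0ℚ ≤ w S) → ∀ S → 0ℚ ≤ restrict Φ w S
  restrict-nonNeg Φ w w≥0 S with S ∈? members Φ
  ... | yes S∈ = w≥0 S∈
  ... | no _   = ≤-refl

  total-supported : ∀ (w : Weight N) Φ → SupportedOn w Φ → ∀ i →
    total w i ≡ ∑ (members Φ) (λ S → w S * χ S i)
  total-supported {N} w Φ w⊆Φ i = sym (∑-support _≟ˢ_ (unique Φ) (subsets-unique N) (λ {S} _ → ∈-subsets S)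
    λ {S} S∉ → trans (cong (_* χ S i) (vanishes {Φ = Φ} w⊆Φ S∉)) (*-zeroˡ (χ S i)))

  total-restrict : ∀ Φ (w : Weight N) i → total (restrict Φ w) i ≡ ∑ (members Φ) (λ S → w S * χ S i)
  total-restrict Φ w i = trans (total-supported _ Φ (restrict-supported Φ w) i)
    (∑-cong (members Φ) λ {S} S∈ → cong (_* χ S i) (restrict-∈ Φ w S∈))

  seq-fromℚ : ∀ Φ {w : Weight N} → SupportedOn w Φ → ∀ i n →
    seq (combination Φ (fromℚ ∘ w) i) n ≡ total w i
  seq-fromℚ Φ w⊆Φ i n = trans (seq-combination Φ _ i n) (sym (total-supported _ Φ w⊆Φ i))

  constant-≃ : ∀ {x : ℝ} {q} → (∀ n → seq x n ≡ q) → x ≃ fromℚ q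
  constant-≃ {q = q} eq = Null-cong (λ n → trans (sym (+-inverseʳ q)) (cong (_- q) (sym (eq n)))) Null-0

  NonzeroRelation : Weight N → Set
  NonzeroRelation c = Relation c × (∃[ S ] c S ≢ 0ℚ)

  relation⇒dependent : ∀ Φ {c : Weight N} → NonzeroRelation c → SupportedOn c Φ → LinearlyDependent Φ
  relation⇒dependent Φ {c} (rel , S , cS≢0) c⊆Φ = fromℚ ∘ c
    , lose (c⊆Φ cS≢0) (λ c≃0 → cS≢0 (Null-const (Null-cong (λ _ → +-identityʳ (c S)) c≃0)))
    , λ i → constant-≃ {combination Φ (fromℚ ∘ c) i} λ n → trans (seq-fromℚ Φ c⊆Φ i n) (rel i)

  balancedWeight⇒balanced : ∀ Φ {w : Weight N} → BalancedWeight w → SupportedOn w Φ →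
    (∀ {S} → S ∈ members Φ → w S ≢ 0ℚ) → Balanced Φ
  balancedWeight⇒balanced Φ {w} (w≥0 , w-total) w⊆Φ w≢0 = fromℚ ∘ w
    , All.tabulate (λ {S} S∈ → let 0<w = ≤∧≢⇒< (w≥0 S) (w≢0 S∈ ∘ sym) in
        -- The order on ℝ asks for a gap ε with 0 + ε strictly below `w S`; half of `w S` is such a
        -- gap.
        ½ * w S , 0<* 0<½ 0<w , 0 , λ _ _ → ≤-<-trans (≤-reflexive (+-identityˡ (½ * w S))) (½*< 0<w))
    , λ i → constant-≃ {combination Φ (fromℚ ∘ w) i} λ n → trans (seq-fromℚ Φ w⊆Φ i n) (w-total i)

  module _ (Φ : Collection N) where

    private
      u : Subset N → Fin N → ℚ
      u = proj₁ (gInverse _≟ˢ_ χ (unique Φ))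

      u-inverse : IsGInverse _≟ˢ_ χ (members Φ) u
      u-inverse = proj₂ (gInverse _≟ˢ_ χ (unique Φ))

      P : (Fin N → ℚ) → Fin N → ℚ
      P = project _≟ˢ_ χ (members Φ) u

      -- I - LA, whose rows are relations because A L A = A
      defect : Subset N → Subset N → ℚ
      defect S T = δ _≟ˢ_ S T - u T ∙ χ S

      defect-relation : ∀ {S} → S ∈ members Φ → Relation (restrict Φ (defect S))
      defect-relation {S} S∈ i = begin
        total (restrict Φ (defect S)) i                                ≡⟨ total-restrict Φ (defect S) i ⟩
        ∑ (members Φ) (λ T → (δ _≟ˢ_ S T - u T ∙ χ S) * χ T i)
          ≡⟨ ∑-cong (members Φ) (λ {T} _ → expand (δ _≟ˢ_ S T) (u T ∙ χ S) (χ T i)) ⟩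
        ∑ (members Φ) (λ T → δ _≟ˢ_ S T * χ T i + (- 1ℚ) * (u T ∙ χ S * χ T i))
          ≡⟨ trans (∑-+ (members Φ) _ _) (cong₂ _+_ (∑-δ _≟ˢ_ (λ T → χ T i) (unique Φ) S∈)
               (trans (∑-*ˡ (members Φ) (- 1ℚ) _) (cong ((- 1ℚ) *_) (u-inverse S∈ i)))) ⟩
        χ S i + (- 1ℚ) * χ S i                                         ≡⟨ cancel (χ S i) ⟩
        0ℚ                                                             ∎
        where
        open ≡-Reasoning
        open +-*-Solver
        expand : ∀ a b c → (a - b) * c ≡ a * c + (- 1ℚ) * (b * c)
        expand = solve 3 (λ a b c → (a :- b) :* c := a :* c :+ (:- con 1ℚ) :* (b :* c)) refl
        cancel : ∀ a → a + (- 1ℚ) * a ≡ 0ℚ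
        cancel = solve 1 (λ a → a :+ (:- con 1ℚ) :* a := con 0ℚ) refl

      -- When I - L A is zero on Φ, the rational matrix L also inverts A on real coefficients:
      -- applied to the n-th stage of a combination it returns `seq (c T) n`. A combination equal to
      -- zero therefore forces `c T ≃ 0ℝ`.
      left-inverse⇒independent : (∀ {S T} → S ∈ members Φ → T ∈ members Φ → defect S T ≡ 0ℚ) → ¬ LinearlyDependent Φ
      left-inverse⇒independent defect≡0 (c , some , c-comb) with T , T∈ , cT≄0 ← find some = cT≄0
        (Null-cong (λ n → trans (u-combination n) (sym (+-identityʳ (seq (c T) n)))) (Null-∙ (u T) comb→0))
        where
        comb : ℕ → Fin N → ℚ
        comb n i = ∑ (members Φ) λ S → seq (c S) n * χ S i
        comb→0 : ∀ i → Null (λ n → comb n i)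
        comb→0 i = Null-cong (λ n → trans (+-identityʳ _) (seq-combination Φ c i n)) (c-comb i)
        u-combination : ∀ n → u T ∙ comb n ≡ seq (c T) n
        u-combination n = begin
          u T ∙ comb n                                              ≡⟨ ∙-∑ (members Φ) (u T) (λ S → seq (c S) n) χ ⟩
          ∑ (members Φ) (λ S → seq (c S) n * u T ∙ χ S)             ≡⟨ ∑-cong (members Φ) (λ {S} S∈ → trans
               (cong (seq (c S) n *_) (trans (u≡δ S∈) (δ-sym S))) (*-comm (seq (c S) n) _)) ⟩
          ∑ (members Φ) (λ S → δ _≟ˢ_ T S * seq (c S) n)            ≡⟨ ∑-δ _≟ˢ_ (λ S → seq (c S) n) (unique Φ) T∈ ⟩
          seq (c T) n                                               ∎
          where
          open ≡-Reasoning
          open +-*-Solver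
          u≡δ : ∀ {S} → S ∈ members Φ → u T ∙ χ S ≡ δ _≟ˢ_ S T
          u≡δ {S} S∈ = trans (shift (δ _≟ˢ_ S T) (u T ∙ χ S))
            (trans (cong (λ z → δ _≟ˢ_ S T - z) (defect≡0 S∈ T∈)) (+-identityʳ _))
            where
            shift : ∀ a b → b ≡ a - (a - b)
            shift = solve 2 (λ a b → b := a :- (a :- b)) refl
          δ-sym : ∀ S → δ _≟ˢ_ S T ≡ δ _≟ˢ_ T S
          δ-sym S with S ≟ˢ T
          ... | yes refl = sym (δ-≡ _≟ˢ_ S)
          ... | no S≢T   = sym (δ-≢ _≟ˢ_ (S≢T ∘ sym))

    private
      -- A finite rational test for dependence over ℝ. A nonzero entry of I - L A lies in a row that
      -- is a nonzero relation; if there is none, L is a left inverse and Φ is independent.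
      HasDefect : Set
      HasDefect = Any (λ S → Any (λ T → defect S T ≢ 0ℚ) (members Φ)) (members Φ)

      hasDefect? : Dec HasDefect
      hasDefect? = any? (λ S → any? (λ T → ¬? (defect S T ≟ 0ℚ)) (members Φ)) (members Φ)

      defect⇒relation : HasDefect → ∃[ c ] NonzeroRelation c × SupportedOn c Φ
      defect⇒relation some with S , S∈ , some′ ← find some with T , T∈ , d≢0 ← find some′ =
        restrict Φ (defect S)
        , (defect-relation S∈ , T , d≢0 ∘ trans (sym (restrict-∈ Φ (defect S) T∈)))
        , restrict-supported Φ (defect S)

      no-defect⇒independent : ¬ HasDefect → ¬ LinearlyDependent Φ
      no-defect⇒independent none = left-inverse⇒independent λ {S} {T} S∈ T∈ →
        decidable-stable (defect S T ≟ 0ℚ) λ d≢0 → none (lose S∈ (lose T∈ d≢0))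

    -- The relation is a row of I - L A. It is not an approximation of the given real coefficients,
    -- which serve only to rule out independence.
    dependent⇒relation : LinearlyDependent Φ → ∃[ c ] NonzeroRelation c × SupportedOn c Φ
    dependent⇒relation dep with hasDefect?
    ... | yes some = defect⇒relation some
    ... | no none  = contradiction dep (no-defect⇒independent none)

    dependent? : Dec (LinearlyDependent Φ)
    dependent? with hasDefect?
    ... | yes some = let c , c-rel , c⊆Φ = defect⇒relation some in yes (relation⇒dependent Φ c-rel c⊆Φ)
    ... | no none  = no (no-defect⇒independent none)

    -- The n-th stage of the real weights solves A q = 1 up to an error tending to zero, and adding
    -- L applied to the error makes the solution exact. Each real weight exceeds some ε > 0 while
    -- the correction tends to zero, so late stages remain non-negative. Some weights may become
    -- zero; minimality excludes this later.
    balanced⇒balancedWeight : Balanced Φ → ∃[ w ] BalancedWeight w × SupportedOn w Φ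
    balanced⇒balancedWeight (w , w>0 , w-comb) =
      restrict Φ v , (restrict-nonNeg Φ v (proj₂ stage) , v-total) , restrict-supported Φ v
      where
      q : ℕ → Subset N → ℚ
      q n S = seq (w S) n
      comb : ℕ → Fin N → ℚ
      comb n i = ∑ (members Φ) λ S → q n S * χ S i
      𝟏 : Fin N → ℚ
      𝟏 _ = 1ℚ
      error : ℕ → Fin N → ℚ
      error n i = 1ℚ - comb n i
      error→0 : ∀ i → Null (λ n → error n i)
      error→0 i = Null-cong (λ n → trans (cong (λ z → (- 1ℚ) * (z - 1ℚ)) (seq-combination Φ w i n)) (negate (comb n i)))
                    (Null-* (- 1ℚ) (w-comb i))
        where
        open +-*-Solver
        negate : ∀ a → (- 1ℚ) * (a - 1ℚ) ≡ 1ℚ - a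
        negate = solve 1 (λ a → (:- con 1ℚ) :* (a :- con 1ℚ) := con 1ℚ :- a) refl
      P-error : ∀ n i → P (error n) i ≡ P 𝟏 i - comb n i
      P-error n i = trans (project-minus _≟ˢ_ χ (members Φ) u 𝟏 (comb n) i)
        (cong (λ z → P 𝟏 i - z) (project-span _≟ˢ_ χ {u = u} u-inverse (q n) i))
      -- `P` fixes `comb n`, so `P (error n) - error n` equals `P 𝟏 - 𝟏` for every n. This constant
      -- sequence tends to zero, hence is zero.
      P-𝟏 : ∀ i → P 𝟏 i ≡ 1ℚ
      P-𝟏 i = trans (shift (P 𝟏 i)) (trans (cong (_+ 1ℚ) (Null-const difference→0)) (+-identityˡ 1ℚ))
        where
        open +-*-Solver
        P-error→0 : Null (λ n → P (error n) i)
        P-error→0 = Null-cong (λ n → ∑-cong (members Φ) λ {S} _ → *-comm (χ S i) (u S ∙ error n))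
          (Null-∑ (members Φ) (λ S → χ S i) λ S → Null-∙ (u S) error→0)
        shift : ∀ a → a ≡ (a - 1ℚ) + 1ℚ
        shift = solve 1 (λ a → a := (a :- con 1ℚ) :+ con 1ℚ) refl
        cancel : ∀ a b → (a - b) + (- 1ℚ) * (1ℚ - b) ≡ a - 1ℚ
        cancel = solve 2 (λ a b → (a :- b) :+ (:- con 1ℚ) :* (con 1ℚ :- b) := a :- con 1ℚ) refl
        difference : ∀ n → P (error n) i + (- 1ℚ) * error n i ≡ P 𝟏 i - 1ℚ
        difference n = trans (cong (_+ (- 1ℚ) * error n i) (P-error n i)) (cancel (P 𝟏 i) (comb n i))
        difference→0 : Null (λ _ → P 𝟏 i - 1ℚ)
        difference→0 = Null-cong difference
          (Null-+ {λ n → P (error n) i} {λ n → (- 1ℚ) * error n i} P-error→0 (Null-* (- 1ℚ) (error→0 i)))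
      -- A rational approximation of the real weights, corrected to an exact solution.
      corrected : ℕ → Subset N → ℚ
      corrected n S = q n S + u S ∙ error n
      eventually-positive : ∀ {S} → S ∈ members Φ → Eventually (λ n → 0ℚ ≤ corrected n S)
      eventually-positive {S} S∈ with ε , 0<ε , w>ε ← All.lookup w>0 S∈ =
        Eventually-map (λ {n} (q>ε , small) → sum-nonNeg (q n S) (u S ∙ error n) q>ε small)
          (Eventually-× w>ε (Null-∙ (u S) error→0 ε 0<ε))
        where
        sum-nonNeg : ∀ a b → 0ℚ + ε < a → ∣ b ∣ < ε → 0ℚ ≤ a + b
        sum-nonNeg a b ε<a ∣b∣<ε = begin
          0ℚ               ≡⟨ +-inverseʳ ε ⟨
          ε - ε            ≤⟨ +-mono-≤ (≤-trans (≤-reflexive (sym (+-identityˡ ε))) (<⇒≤ ε<a)) -ε≤b ⟩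
          a + b            ∎
          where
          open ≤-Reasoning
          -ε≤b : - ε ≤ b
          -ε≤b = begin
            - ε         ≤⟨ neg-antimono-≤ (<⇒≤ ∣b∣<ε) ⟩
            - ∣ b ∣     ≤⟨ -∣p∣≤p b ⟩
            b           ∎
      stage : ∃[ n ] (∀ {S} → S ∈ members Φ → 0ℚ ≤ corrected n S)
      stage = let k , h = Eventually-All (All.tabulate eventually-positive) in k , All.lookup (h k ℕ.≤-refl)
      n₀ = proj₁ stage
      v = corrected n₀
      v-total : ∀ i → total (restrict Φ v) i ≡ 1ℚ
      v-total i = begin
        total (restrict Φ v) i                    ≡⟨ total-restrict Φ v i ⟩
        ∑ (members Φ) (λ S → v S * χ S i)         ≡⟨ ∑-cong (members Φ) (λ {S} _ → *-distribʳ-+ (χ S i) (q n₀ S) (u S ∙ error n₀)) ⟩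
        ∑ (members Φ) (λ S → q n₀ S * χ S i + u S ∙ error n₀ * χ S i)  ≡⟨ ∑-+ (members Φ) _ _ ⟩
        comb n₀ i + P (error n₀) i                ≡⟨ cong (comb n₀ i +_) (trans (P-error n₀ i) (cong (_- comb n₀ i) (P-𝟏 i))) ⟩
        comb n₀ i + (1ℚ - comb n₀ i)              ≡⟨ cancel (comb n₀ i) ⟩
        1ℚ                                        ∎
        where
        open ≡-Reasoning
        open +-*-Solver
        cancel : ∀ a → a + (1ℚ - a) ≡ 1ℚ
        cancel = solve 1 (λ a → a :+ (con 1ℚ :- a) := con 1ℚ) refl

  -- Weights of minimal support

  -- Minimality expressed through weights: no weight of kind `X` on Φ may miss a member.
  -- Contradictions then come from producing a weight with a single zero, with no subcollection to
  -- construct.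
  Elementary : (Weight N → Set) → Collection N → Set
  Elementary X Φ = (∃[ w ] X w × SupportedOn w Φ)
                 × (∀ w → X w → SupportedOn w Φ → ∀ {S} → S ∈ members Φ → w S ≢ 0ℚ)

  support : Weight N → Collection N → Collection N
  support w Φ = record
    { members = filter (λ S → ¬? (w S ≟ 0ℚ)) (members Φ)
    ; unique  = Unique.filter⁺ (λ S → ¬? (w S ≟ 0ℚ)) (unique Φ)
    }

  module _ {P : Collection N → Set} {X : Weight N → Set}
    (weights    : ∀ Φ → P Φ → ∃[ w ] X w × SupportedOn w Φ)
    (fromWeight : ∀ Φ {w} → X w → SupportedOn w Φ → (∀ {S} → S ∈ members Φ → w S ≢ 0ℚ) → P Φ)
    where

    -- A weight vanishing at a member would have as its support a proper subcollection that still
    -- satisfies `P`.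
    minimal⇒elementary : ∀ {Φ} → Minimal P Φ → Elementary X Φ
    minimal⇒elementary {Φ} (PΦ , minimal) = weights Φ PΦ , λ w Xw w⊆Φ {S} S∈ wS≡0 →
      minimal (support w Φ)
        ( (λ T∈ → proj₁ (∈-filter⁻ (λ S → ¬? (w S ≟ 0ℚ)) T∈))
        , (λ Φ⊆ → proj₂ (∈-filter⁻ (λ S → ¬? (w S ≟ 0ℚ)) {xs = members Φ} (Φ⊆ S∈)) wS≡0))
        (fromWeight (support w Φ) Xw
          (λ wT≢0 → ∈-filter⁺ (λ S → ¬? (w S ≟ 0ℚ)) (w⊆Φ wT≢0) wT≢0)
          (λ T∈ → proj₂ (∈-filter⁻ (λ S → ¬? (w S ≟ 0ℚ)) {xs = members Φ} T∈)))

    -- A weight on a subcollection Ψ satisfying `P` is also a weight on Φ, so it is nonzero on all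
    -- of Φ, and Ψ cannot be proper.
    elementary⇒minimal : ∀ {Φ} → Elementary X Φ → Minimal P Φ
    elementary⇒minimal {Φ} ((w , Xw , w⊆Φ) , full) =
      fromWeight Φ Xw w⊆Φ (full w Xw w⊆Φ) , λ Ψ (Ψ⊆Φ , Φ⊈Ψ) PΨ →
        let v , Xv , v⊆Ψ = weights Ψ PΨ in
        Φ⊈Ψ λ S∈ → v⊆Ψ (full v Xv (λ vS≢0 → Ψ⊆Φ (v⊆Ψ vS≢0)) S∈)

  not-balanced : ∀ {w : Weight N} i → BalancedWeight w → ¬ (∀ S → w S * χ S i ≡ 0ℚ)
  not-balanced {N} i (_ , w-total) terms≡0 with trans (sym (w-total i)) (∑-zero (subsets N) λ {S} _ → terms≡0 S)
  ... | ()

  SupportedOn-combination : ∀ a b (v w : Weight N) {Φ} → SupportedOn v Φ → SupportedOn w Φ →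
    SupportedOn (λ S → a * v S + b * w S) Φ
  SupportedOn-combination a b v w {Φ} v⊆Φ w⊆Φ {S} ≢0 = decidable-stable (S ∈? members Φ) λ S∉ →
    ≢0 (cong₂ _+_ (trans (cong (a *_) (vanishes {Φ = Φ} v⊆Φ S∉)) (*-zeroʳ a))
                  (trans (cong (b *_) (vanishes {Φ = Φ} w⊆Φ S∉)) (*-zeroʳ b)))

  Relation-combination : ∀ a b (v w : Weight N) → Relation v → Relation w → Relation (λ S → a * v S + b * w S)
  Relation-combination a b v w v-rel w-rel i = trans (total-linear a b v w i)
    (cong₂ _+_ (trans (cong (a *_) (v-rel i)) (*-zeroʳ a)) (trans (cong (b *_) (w-rel i)) (*-zeroʳ b)))

  negate-relation : ∀ (v : Weight N) → Relation v → Relation (-_ ∘ v)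
  negate-relation v v-rel i = trans (total-cong (λ S → negate (v S)) i) (Relation-combination (- 1ℚ) 0ℚ v v v-rel v-rel i)
    where
    open +-*-Solver
    negate : ∀ a → - a ≡ (- 1ℚ) * a + 0ℚ * a
    negate = solve 1 (λ a → :- a := (:- con 1ℚ) :* a :+ con 0ℚ :* a) refl

  relation-vanishes : ∀ {Φ : Collection N} → Elementary NonzeroRelation Φ → ∀ {c} → Relation c → SupportedOn c Φ →
    ∀ {S} → S ∈ members Φ → c S ≡ 0ℚ → ∀ T → c T ≡ 0ℚ
  relation-vanishes (_ , full) {c} c-rel c⊆Φ S∈ cS≡0 T = decidable-stable (c T ≟ 0ℚ) λ cT≢0 →
    full c (c-rel , T , cT≢0) c⊆Φ S∈ cS≡0

  >⇒≢ : ∀ {p} → 0ℚ < p → p ≢ 0ℚ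
  >⇒≢ 0<p p≡0 = <-irrefl (sym p≡0) 0<p

  recip-nonNeg : ∀ {q} → 0ℚ < q → 0ℚ ≤ recip q
  recip-nonNeg {q} 0<q = *-cancelʳ-≤-pos q {{positive 0<q}}
    (≤-trans (≤-reflexive (*-zeroˡ q)) (≤-trans (nonNegative⁻¹ 1ℚ) (≤-reflexive (sym (recip-inverse (>⇒≢ 0<q))))))

  0≤* : ∀ {p q} → 0ℚ ≤ p → 0ℚ ≤ q → 0ℚ ≤ p * q
  0≤* {p} {q} 0≤p 0≤q = ≤-trans (≤-reflexive (sym (*-zeroʳ p))) (*-monoˡ-≤-nonNeg p {{nonNegative 0≤p}} 0≤q)

  module _ {Φ : Collection N} {w : Weight N} (w-bal : BalancedWeight w) (w⊆Φ : SupportedOn w Φ) where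

    -- Move from w against v until the first coordinate vanishes.
    reach-boundary : ∀ {v} → Relation v → SupportedOn v Φ → ∀ {S} → 0ℚ < v S →
      ∃[ w′ ] BalancedWeight w′ × SupportedOn w′ Φ × (∃[ S ] S ∈ members Φ × w′ S ≡ 0ℚ)
    reach-boundary {v} v-rel v⊆Φ {S₀} 0<vS₀ = w′ , (w′≥0 , w′-total)
      , SupportedOn-combination 1ℚ (- t) w v {Φ = Φ} w⊆Φ v⊆Φ
      , S* , v⊆Φ (>⇒≢ 0<vS*)
      , trans (cong (λ z → 1ℚ * w S* + z) (trans (sym (neg-distribˡ-* t (v S*))) (cong -_ (ratio-* 0<vS*)))) (vanish (w S*))
      where
      open +-*-Solver
      ratio : Subset N → ℚ
      ratio S = w S * recip (v S)
      ratio-* : ∀ {S} → 0ℚ < v S → ratio S * v S ≡ w S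
      ratio-* {S} 0<vS = trans (*-assoc (w S) (recip (v S)) (v S))
        (trans (cong (w S *_) (recip-inverse (>⇒≢ 0<vS))) (*-identityʳ (w S)))
      candidates : List (Subset N)
      candidates = filter (λ S → 0ℚ <? v S) (members Φ)
      -- The ratio test of linear programming: only coordinates with `v S` positive decrease, and
      -- the least ratio is the largest admissible step. The default `S₀` also has `v` positive, so
      -- `S*` does in either case.
      S* : Subset N
      S* = argmin ratio S₀ candidates
      0<vS* : 0ℚ < v S*
      0<vS* = argmin-all ratio 0<vS₀ (All.all-filter (λ S → 0ℚ <? v S) (members Φ))
      t : ℚ
      t = ratio S*
      t≥0 : 0ℚ ≤ t
      t≥0 = 0≤* (proj₁ w-bal S*) (recip-nonNeg 0<vS*)
      w′ : Weight N
      w′ S = 1ℚ * w S + (- t) * v S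
      t*v≤w : ∀ S → t * v S ≤ w S
      t*v≤w S with 0ℚ <? v S
      ... | no vS≯0  = ≤-trans (*-monoˡ-≤-nonNeg t {{nonNegative t≥0}} (≮⇒≥ vS≯0))
                         (≤-trans (≤-reflexive (*-zeroʳ t)) (proj₁ w-bal S))
      ... | yes 0<vS = ≤-trans (*-monoʳ-≤-nonNeg (v S) {{nonNegative (<⇒≤ 0<vS)}} t≤ratio) (≤-reflexive (ratio-* 0<vS))
        where
        t≤ratio : t ≤ ratio S
        t≤ratio = All.lookup (f[argmin]≤f[xs] S₀ candidates)
          (∈-filter⁺ (λ S → 0ℚ <? v S) (v⊆Φ (>⇒≢ 0<vS)) 0<vS)
      w′≥0 : ∀ S → 0ℚ ≤ w′ S
      w′≥0 S = begin
        0ℚ                          ≡⟨ +-inverseʳ (t * v S) ⟨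
        t * v S - t * v S           ≤⟨ +-monoˡ-≤ (- (t * v S)) (t*v≤w S) ⟩
        w S - t * v S               ≡⟨ expand (w S) t (v S) ⟩
        1ℚ * w S + (- t) * v S      ∎
        where
        open ≤-Reasoning
        expand : ∀ a b c → a - b * c ≡ 1ℚ * a + (- b) * c
        expand = solve 3 (λ a b c → a :- b :* c := con 1ℚ :* a :+ (:- b) :* c) refl
      w′-total : ∀ i → total w′ i ≡ 1ℚ
      w′-total i = trans (total-linear 1ℚ (- t) w v i)
        (cong₂ _+_ (trans (*-identityˡ _) (proj₂ w-bal i)) (trans (cong ((- t) *_) (v-rel i)) (*-zeroʳ (- t))))
      vanish : ∀ a → 1ℚ * a + (- a) ≡ 0ℚ
      vanish = solve 1 (λ a → con 1ℚ :* a :+ (:- a) := con 0ℚ) refl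

  -- A nonzero relation, or its negative, has a positive entry. Moving a balanced weight against it
  -- preserves the totals and reaches a zero at some member, which `full` forbids.
  balanced-independent : ∀ {Φ : Collection N} → Elementary BalancedWeight Φ →
    ∀ {v} → Relation v → SupportedOn v Φ → ∀ S → v S ≡ 0ℚ
  balanced-independent {Φ = Φ} ((w , w-bal , w⊆Φ) , full) {v} v-rel v⊆Φ S with <-cmp 0ℚ (v S)
  ... | tri≈ _ 0≡vS _ = sym 0≡vS
  ... | tri< 0<vS _ _ =
    let w′ , w′-bal , w′⊆Φ , T , T∈ , w′T≡0 = reach-boundary {Φ = Φ} {w} w-bal w⊆Φ v-rel v⊆Φ 0<vS
    in contradiction w′T≡0 (full w′ w′-bal w′⊆Φ T∈)
  ... | tri> _ _ vS<0 =
    let w′ , w′-bal , w′⊆Φ , T , T∈ , w′T≡0 =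
          reach-boundary {Φ = Φ} {w} w-bal w⊆Φ -v-rel -v⊆Φ {S} (neg-antimono-< vS<0)
    in contradiction w′T≡0 (full w′ w′-bal w′⊆Φ T∈)
    where
    -v-rel : Relation (-_ ∘ v)
    -v-rel = negate-relation v v-rel
    -v⊆Φ : SupportedOn (-_ ∘ v) Φ
    -v⊆Φ -vS≢0 = v⊆Φ λ vS≡0 → -vS≢0 (cong (λ z → - z) vS≡0)

  -- Minimal balanced collections and circuits

  infix 4 _≈_

  record _≈_ (Φ Ψ : Collection N) : Set where
    constructor ⊆-antisym
    field
      ≈⇒⊆ : members Φ ⊆ members Ψ
      ≈⇒⊇ : members Ψ ⊆ members Φ

  open _≈_

  -- Signs are coded like `side`: `true` stands for negative, because sets containing the extra
  -- element enter `reduce` with a minus sign.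
  neg? : ℚ → Bool
  neg? q = does (q <? 0ℚ)

  signed : Bool → ℚ → ℚ
  signed false q = q
  signed true  q = - q

  signed-involutive : ∀ b q → signed b (signed b q) ≡ q
  signed-involutive false q = refl
  signed-involutive true  q = ⁻¹-involutive q

  signed-zero : ∀ b → signed b 0ℚ ≡ 0ℚ
  signed-zero false = refl
  signed-zero true  = refl

  signed≡0 : ∀ b {q} → signed b q ≡ 0ℚ → q ≡ 0ℚ
  signed≡0 b {q} eq = trans (sym (signed-involutive b q)) (trans (cong (signed b) eq) (signed-zero b))

  neg?-signed : ∀ b {q} → 0ℚ < q → neg? (signed b q) ≡ b
  neg?-signed false {q} 0<q = dec-false (q <? 0ℚ) (<-asym 0<q)
  neg?-signed true  {q} 0<q = dec-true (- q <? 0ℚ) (neg-antimono-< 0<q)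

  0<∣_∣ : ∀ {q} → q ≢ 0ℚ → 0ℚ < ∣ q ∣
  0<∣_∣ {q} q≢0 = ≤∧≢⇒< (0≤∣p∣ q) λ eq → q≢0 (∣p∣≡0⇒p≡0 q (sym eq))

  signed-abs : ∀ q → signed (neg? q) ∣ q ∣ ≡ q
  signed-abs q = go (q <? 0ℚ)
    where
    go : (d : Dec (q < 0ℚ)) → signed (does d) ∣ q ∣ ≡ q
    go (no q≮0)  = 0≤p⇒∣p∣≡p (≮⇒≥ q≮0)
    go (yes q<0) = trans (cong (λ z → - z) (trans (sym (∣-p∣≡∣p∣ q)) (0≤p⇒∣p∣≡p (neg-antimono-≤ (<⇒≤ q<0)))))
                     (⁻¹-involutive q)

  neg?-neg : ∀ {q} → q ≢ 0ℚ → neg? (- q) ≡ not (neg? q)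
  neg?-neg {q} q≢0 = trans (cong (λ z → neg? (- z)) (sym (signed-abs q))) (flip (neg? q))
    where
    flip : ∀ b → neg? (- signed b ∣ q ∣) ≡ not b
    flip false = neg?-signed true 0<∣ q≢0 ∣
    flip true  = trans (cong neg? (⁻¹-involutive ∣ q ∣)) (neg?-signed false 0<∣ q≢0 ∣)

  reduce-one-sided : ∀ (w : Weight (suc n)) b {T} → w (lift (not b) T) ≡ 0ℚ → reduce w T ≡ signed b (w (lift b T))
  reduce-one-sided w false {T} eq = trans (cong (λ z → w (lift false T) - z) eq) (+-identityʳ _)
  reduce-one-sided w true  {T} eq = trans (cong (_- w (lift true T)) eq) (+-identityˡ _)

  reduce-relation : {w : Weight (suc n)} → (∀ i → total w i ≡ total w zero) → Relation (reduce w)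
  reduce-relation {w = w} constant i = ∙-cancelˡ (total w zero) (total (reduce w) i) 0ℚ
    (trans (sym (total-suc w i)) (trans (constant (suc i)) (sym (+-identityʳ _))))

  -- Degenerate collections: complementary pairs and {[n+1]}

  pairOf : ∀ {U : Subset n} → Dec (Nonempty U) → List (Subset (suc n))
  pairOf {U = U} (yes _) = lift false U ∷ lift true U ∷ []
  pairOf {U = U} (no _)  = lift true U ∷ []

  -- {S, ∁ S} for the sets S with base U, except that {∅, [n+1]} loses ∅.
  pair : Subset n → Collection (suc n)
  pair {n} U = record { members = pairOf (nonempty? U) ; unique = distinct (nonempty? U) }
    where
    distinct : (d : Dec (Nonempty U)) → Unique (pairOf d)
    distinct (yes _) = ((λ eq → contradiction (cong side eq) λ ()) ∷ []) ∷ [] ∷ []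
    distinct (no _)  = [] ∷ []

  pair-∈ : ∀ {U : Subset n} {S} (d : Dec (Nonempty U)) → S ∈ pairOf d → ∃[ b ] S ≡ lift b U
  pair-∈ (yes _) (here eq)         = false , eq
  pair-∈ (yes _) (there (here eq)) = true , eq
  pair-∈ (no _)  (here eq)         = true , eq

  lift-true∈pair : ∀ (U : Subset n) → lift true U ∈ members (pair U)
  lift-true∈pair U = go (nonempty? U)
    where
    go : (d : Dec (Nonempty U)) → lift true U ∈ pairOf d
    go (yes _) = there (here refl)
    go (no _)  = here refl

  length-pair : ∀ (U : Subset n) → size (pair U) ℕ.≤ 2
  length-pair U = go (nonempty? U)
    where
    go : (d : Dec (Nonempty U)) → length (pairOf d) ℕ.≤ 2
    go (yes _) = ℕ.s≤s (ℕ.s≤s ℕ.z≤n)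
    go (no _)  = ℕ.s≤s ℕ.z≤n

  pair-injective : ∀ {U V : Subset n} → pair U ≈ pair V → U ≡ V
  pair-injective {U = U} {V} eq with pair-∈ (nonempty? V) (≈⇒⊆ eq (lift-true∈pair U))
  ... | true , eq′ = lift-injective true eq′

  χ-∈ : ∀ {U : Subset n} {i} → i Subset.∈ U → χ U i ≡ 1ℚ
  χ-∈ i∈ = cong (if_then 1ℚ else 0ℚ) ([]=⇒lookup i∈)

  χ-empty : ∀ {U : Subset n} → ¬ Nonempty U → ∀ i → χ U i ≡ 0ℚ
  χ-empty {U = U} empty i with lookup U i in eq
  ... | true  = contradiction (i , lookup⇒[]= i U eq) empty
  ... | false = refl

  pairWeight : Subset n → Weight (suc n)
  pairWeight U = restrict (pair U) (λ _ → 1ℚ)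

  pairWeight-balanced : ∀ (U : Subset n) → BalancedWeight (pairWeight U)
  pairWeight-balanced U = restrict-nonNeg (pair U) (λ _ → 1ℚ) (λ _ → nonNegative⁻¹ 1ℚ)
    , λ i → trans (total-restrict (pair U) (λ _ → 1ℚ) i) (go (nonempty? U) i)
    where
    open +-*-Solver
    go : (d : Dec (Nonempty U)) → ∀ i → ∑ (pairOf d) (λ S → 1ℚ * χ S i) ≡ 1ℚ
    go (yes _) zero    = refl
    go (no _)  zero    = refl
    go (yes _) (suc i) = trans (cong (λ z → 1ℚ * χ U i + (1ℚ * z + 0ℚ)) (χ-∁ U i)) (cancel (χ U i))
      where
      cancel : ∀ a → 1ℚ * a + (1ℚ * (1ℚ - a) + 0ℚ) ≡ 1ℚ
      cancel = solve 1 (λ a → con 1ℚ :* a :+ (con 1ℚ :* (con 1ℚ :- a) :+ con 0ℚ) := con 1ℚ) refl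
    go (no empty) (suc i) = cong (λ z → 1ℚ * z + 0ℚ) (trans (χ-∁ U i) (cong (λ z → 1ℚ - z) (χ-empty empty i)))

  -- Each member is the only one to cover some coordinate: an element of `U` for `lift false U`, the
  -- extra element for `lift true U`. A weight vanishing at that member would have total 0 there.
  pair-elementary : ∀ (U : Subset n) → Elementary BalancedWeight (pair U)
  pair-elementary {n} U = (pairWeight U , pairWeight-balanced U , restrict-supported (pair U) _)
    , λ w w-bal w⊆ S∈ wS≡0 →
      let i , others = go (nonempty? U) S∈
      in not-balanced i w-bal λ T → zeros w w⊆ wS≡0 others T
    where
    go : (d : Dec (Nonempty U)) → ∀ {S} → S ∈ pairOf d → ∃[ i ] (∀ {T} → T ∈ pairOf d → T ≢ S → χ T i ≡ 0ℚ)
    go (yes (i , i∈)) (here refl) = suc i , λ where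
      (here refl) T≢S         → contradiction refl T≢S
      (there (here refl)) T≢S → trans (χ-∁ U i) (cong (λ z → 1ℚ - z) (χ-∈ i∈))
    go (yes _) (there (here refl)) = zero , λ where
      (here refl) T≢S         → refl
      (there (here refl)) T≢S → contradiction refl T≢S
    go (no _) (here refl) = zero , λ where
      (here refl) T≢S → contradiction refl T≢S
    zeros : ∀ w → SupportedOn w (pair U) → ∀ {S i} → w S ≡ 0ℚ →
      (∀ {T} → T ∈ members (pair U) → T ≢ S → χ T i ≡ 0ℚ) → ∀ T → w T * χ T i ≡ 0ℚ
    zeros w w⊆ {S} {i} wS≡0 others T with T ≟ˢ S | T ∈? members (pair U)
    ... | yes refl | _      = trans (cong (_* χ T i) wS≡0) (*-zeroˡ (χ T i))
    ... | no T≢S   | yes T∈ = trans (cong (w T *_) (others T∈ T≢S)) (*-zeroʳ (w T))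
    ... | no _     | no T∉  = trans (cong (_* χ T i) (vanishes {Φ = pair U} w⊆ T∉)) (*-zeroˡ (χ T i))

  -- Excludes both members over the same base, which makes `base` injective on Φ, and with `U` empty
  -- also excludes the full set [n+1].
  Simple : Collection (suc n) → Set
  Simple Φ = ∀ U → ¬ (members (pair U) ⊆ members Φ)

  pair⊆? : ∀ (Φ : Collection (suc n)) U → Dec (members (pair U) ⊆ members Φ)
  pair⊆? Φ U = map′ All.lookup All.tabulate (All.all? (_∈? members Φ) (members (pair U)))

  simple? : ∀ (Φ : Collection (suc n)) → Simple Φ ⊎ (∃[ U ] members (pair U) ⊆ members Φ)
  simple? {n} Φ with any? (pair⊆? Φ) (subsets n)
  ... | yes some = inj₂ (satisfied some)
  ... | no none  = inj₁ λ U U⊆ → none (lose (∈-subsets U) U⊆)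

  simple-one-sided : ∀ {Φ : Collection (suc n)} → Simple Φ → ∀ b {T} →
    lift b T ∈ members Φ → lift (not b) T ∉ members Φ
  simple-one-sided {Φ = Φ} simple b {T} T∈ T∈′ = simple T λ S∈ →
    let b′ , eq = pair-∈ (nonempty? T) S∈ in subst (_∈ members Φ) (sym eq) (go b b′ T∈ T∈′)
    where
    go : ∀ b b′ → lift b T ∈ members Φ → lift (not b) T ∈ members Φ → lift b′ T ∈ members Φ
    go false false p q = p
    go false true  p q = q
    go true  false p q = q
    go true  true  p q = p

  -- `pairWeight U` is a balanced weight on Φ, so by `full` it is nonzero on all of Φ, although it
  -- lives on the pair.
  degenerate⇒pair : ∀ {Φ : Collection (suc n)} {U} → Elementary BalancedWeight Φ →
    members (pair U) ⊆ members Φ → Φ ≈ pair U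
  degenerate⇒pair {U = U} (_ , full) U⊆Φ = ⊆-antisym
    (λ S∈ → restrict-supported (pair U) _ (full (pairWeight U) (pairWeight-balanced U)
       (U⊆Φ ∘ restrict-supported (pair U) (λ _ → 1ℚ)) S∈))
    U⊆Φ

  -- From a simple minimal balanced collection to a circuit

  module _ {Φ : Collection (suc n)} (simple : Simple Φ) (el : Elementary BalancedWeight Φ) where

    private
      w : Weight (suc n)
      w = proj₁ (proj₁ el)
      w-bal : BalancedWeight w
      w-bal = proj₁ (proj₂ (proj₁ el))
      w⊆Φ : SupportedOn w Φ
      w⊆Φ = proj₂ (proj₂ (proj₁ el))
      w-full : ∀ {S} → S ∈ members Φ → w S ≢ 0ℚ
      w-full = proj₂ el w w-bal w⊆Φ
      w>0 : ∀ {S} → S ∈ members Φ → 0ℚ < w S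
      w>0 {S} S∈ = ≤∧≢⇒< (proj₁ w-bal S) (w-full S∈ ∘ sym)

      base-injective : ∀ {S T} → S ∈ members Φ → T ∈ members Φ → base S ≡ base T → S ≡ T
      base-injective {S} {T} S∈ T∈ eq with side S Bool.≟ side T
      ... | yes sides = trans (sym (lift-side-base S)) (trans (cong₂ lift sides eq) (lift-side-base T))
      ... | no sides  = contradiction (subst (_∈ members Φ) opposite T∈)
                          (simple-one-sided {Φ = Φ} simple (side S) (subst (_∈ members Φ) (sym (lift-side-base S)) S∈))
        where
        opposite : T ≡ lift (not (side S)) (base S)
        opposite = trans (sym (lift-side-base T)) (cong₂ lift (¬-not (sides ∘ sym)) (sym eq))

      map-unique : ∀ {Ss : List (Subset (suc n))} →
        (∀ {S T} → S ∈ Ss → T ∈ Ss → base S ≡ base T → S ≡ T) → Unique Ss → Unique (map base Ss)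
      map-unique inj []           = []
      map-unique inj (S∉ ∷ Ss!) =
        All.map⁺ (All.tabulate λ T∈ eq → All.lookup S∉ T∈ (inj (here refl) (there T∈) eq))
        ∷ map-unique (λ S∈ T∈ → inj (there S∈) (there T∈)) Ss!

    bases : Collection n
    bases = record { members = map base (members Φ) ; unique = map-unique base-injective (unique Φ) }

    size-bases : size bases ≡ size Φ
    size-bases = length-map base (members Φ)

    private
      base∈ : ∀ b {T} → lift b T ∈ members Φ → T ∈ members bases
      base∈ b {T} T∈ = subst (_∈ members bases) (base-lift b T) (∈-map⁺ base T∈)

      lifted : ∀ {T} → T ∈ members bases → ∃[ b ] lift b T ∈ members Φ
      lifted T∈ with S , S∈ , refl ← ∈-map⁻ base T∈ = side S , subst (_∈ members Φ) (sym (lift-side-base S)) S∈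

      reduce-supported : ∀ {v} → SupportedOn v Φ → SupportedOn (reduce v) bases
      reduce-supported {v} v⊆Φ {T} r≢0 = decidable-stable (T ∈? members bases) λ T∉ →
        r≢0 (cong₂ _-_ (vanishes {Φ = Φ} v⊆Φ (T∉ ∘ base∈ false)) (vanishes {Φ = Φ} v⊆Φ (T∉ ∘ base∈ true)))

      reduce-∈ : ∀ {v} → SupportedOn v Φ → ∀ b {T} → lift b T ∈ members Φ → reduce v T ≡ signed b (v (lift b T))
      reduce-∈ {v} v⊆Φ b T∈ = reduce-one-sided v b (vanishes {Φ = Φ} v⊆Φ (simple-one-sided {Φ = Φ} simple b T∈))

    -- An empty base comes from [n+1] or from ∅. The first is excluded by `simple`; the second has
    -- characteristic vector zero, so its indicator weight would be a nonzero relation on Φ, against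
    -- `balanced-independent`.
    bases-nonempty : All Nonempty (members bases)
    bases-nonempty = All.tabulate λ {T} T∈ → decidable-stable (nonempty? T) λ empty →
      let b , T∈′ = lifted T∈ in impossible b empty T∈′
      where
      δ-relation : ∀ {T : Subset n} → ¬ Nonempty T → Relation (δ _≟ˢ_ (lift false T))
      δ-relation {T} empty i = trans
        (∑-δ _≟ˢ_ (λ S → χ S i) (subsets-unique (suc n)) (∈-subsets (lift false T))) (χ-empty (empty′ empty) i)
        where
        empty′ : ¬ Nonempty T → ¬ Nonempty (lift false T)
        empty′ empty (suc i , Vec.there i∈) = empty (i , i∈)
      impossible : ∀ b {T} → ¬ Nonempty T → lift b T ∈ members Φ → ⊥
      impossible true {T} empty T∈ = simple T λ S∈ → subst (_∈ members Φ) (sym (only (nonempty? T) S∈)) T∈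
        where
        only : (d : Dec (Nonempty T)) → ∀ {S} → S ∈ pairOf d → S ≡ lift true T
        only (yes nonempty) _  = contradiction nonempty empty
        only (no _) (here eq) = eq
      impossible false {T} empty T∈ with () ← trans (sym (δ-≡ _≟ˢ_ (lift false T)))
        (balanced-independent {Φ = Φ} el (δ-relation empty)
          (λ {S} δ≢0 → subst (_∈ members Φ) (decidable-stable (lift false T ≟ˢ S) (δ≢0 ∘ δ-≢ _≟ˢ_)) T∈) (lift false T))

    relation-of : Weight n
    relation-of = reduce w

    private
      reduce-w-relation : Relation relation-of
      reduce-w-relation = reduce-relation {w = w} λ i → trans (proj₂ w-bal i) (sym (proj₂ w-bal zero))

      reduce-w≢0 : ∀ {T} → T ∈ members bases → relation-of T ≢ 0ℚ
      reduce-w≢0 T∈ eq = let b , T∈′ = lifted T∈ in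
        w-full T∈′ (signed≡0 b (trans (sym (reduce-∈ w⊆Φ b T∈′)) eq))

      inhabited : ∃[ S ] S ∈ members Φ
      inhabited = go (members Φ) refl
        where
        go : ∀ Ss → members Φ ≡ Ss → ∃[ S ] S ∈ members Φ
        go (S ∷ _) eq = S , subst (S ∈_) (sym eq) (here refl)
        go []      eq = contradiction
          (λ S → trans (cong (_* χ S zero) (vanishes {Φ = Φ} w⊆Φ λ S∈ → Any.¬Any[] (subst (S ∈_) eq S∈))) (*-zeroˡ (χ S zero)))
          (not-balanced zero w-bal)

    relation-of-nonzero : NonzeroRelation relation-of
    relation-of-nonzero = reduce-w-relation , (let S , S∈ = inhabited in base S , reduce-w≢0 (∈-map⁺ base S∈))

    relation-of-supported : SupportedOn relation-of bases
    relation-of-supported = reduce-supported w⊆Φ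

    -- The weights of members are positive, so `reduce` gives them the sign of their side. Hence Φ
    -- can be recovered from its bases and the signs of `relation-of`.
    neg?-relation-of : ∀ {S} → S ∈ members Φ → side S ≡ neg? (relation-of (base S))
    neg?-relation-of {S} S∈ = sym (trans (cong neg? (reduce-∈ w⊆Φ (side S) S∈′)) (neg?-signed (side S) (w>0 S∈′)))
      where
      S∈′ : lift (side S) (base S) ∈ members Φ
      S∈′ = subst (_∈ members Φ) (sym (lift-side-base S)) S∈

    -- A relation c on the bases lifts to v with A v = σ 1, so v - σ w is a
    -- relation on Φ and hence zero; if c vanishes at a single base, then σ = 0.
    bases-elementary : Elementary NonzeroRelation bases
    bases-elementary = (relation-of , relation-of-nonzero , relation-of-supported) , full
      where
      full : ∀ c → NonzeroRelation c → SupportedOn c bases → ∀ {T} → T ∈ members bases → c T ≢ 0ℚ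
      full c (c-rel , U , cU≢0) c⊆ {T} T∈ cT≡0 =
        cU≢0 (trans (sym (reduce-v U)) (cong₂ _-_ (v≡0 (lift false U)) (v≡0 (lift true U))))
        where
        c± : Weight (suc n)
        c± S = signed (side S) (c (base S))
        v : Weight (suc n)
        v = restrict Φ c±
        v⊆Φ : SupportedOn v Φ
        v⊆Φ = restrict-supported Φ c±
        v-lift : ∀ b {T} → lift b T ∈ members Φ → v (lift b T) ≡ signed b (c T)
        v-lift b {T} T∈ = trans (restrict-∈ Φ c± T∈) (cong₂ (λ b T → signed b (c T)) (side-lift b T) (base-lift b T))
        reduce-v : ∀ T → reduce v T ≡ c T
        reduce-v T with T ∈? members bases
        ... | yes T∈ = let b , T∈′ = lifted T∈ in
          trans (reduce-∈ v⊆Φ b T∈′) (trans (cong (signed b) (v-lift b T∈′)) (signed-involutive b (c T)))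
        ... | no T∉  = trans (vanishes {Φ = bases} (reduce-supported v⊆Φ) T∉) (sym (vanishes {Φ = bases} c⊆ T∉))
        σ : ℚ
        σ = total v zero
        total-v : ∀ i → total v i ≡ σ
        total-v zero    = refl
        total-v (suc i) = trans (total-suc v i)
          (trans (cong (σ +_) (trans (total-cong reduce-v i) (c-rel i))) (+-identityʳ σ))
        difference-relation : Relation (λ S → 1ℚ * v S + (- σ) * w S)
        difference-relation i = trans (total-linear 1ℚ (- σ) v w i)
          (trans (cong₂ (λ x y → 1ℚ * x + (- σ) * y) (total-v i) (proj₂ w-bal i)) (cancel σ))
          where
          open +-*-Solver
          cancel : ∀ a → 1ℚ * a + (- a) * 1ℚ ≡ 0ℚ
          cancel = solve 1 (λ a → con 1ℚ :* a :+ (:- a) :* con 1ℚ := con 0ℚ) refl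
        difference≡0 : ∀ S → 1ℚ * v S + (- σ) * w S ≡ 0ℚ
        difference≡0 = balanced-independent {Φ = Φ} el difference-relation
          (SupportedOn-combination 1ℚ (- σ) v w {Φ = Φ} v⊆Φ w⊆Φ)
        v≡σ*w : ∀ S → v S ≡ σ * w S
        v≡σ*w S = trans (split (v S) σ (w S)) (trans (cong (_+ σ * w S) (difference≡0 S)) (+-identityˡ _))
          where
          open +-*-Solver
          split : ∀ a b c → a ≡ (1ℚ * a + (- b) * c) + b * c
          split = solve 3 (λ a b c → a := (con 1ℚ :* a :+ (:- b) :* c) :+ b :* c) refl
        σ≡0 : σ ≡ 0ℚ
        σ≡0 = let b , T∈′ = lifted T∈ in
          decidable-stable (σ ≟ 0ℚ) λ σ≢0 → w-full T∈′ (zero-product σ≢0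
            (trans (sym (v≡σ*w _)) (trans (v-lift b T∈′) (trans (cong (signed b) cT≡0) (signed-zero b)))))
          where
          zero-product : ∀ {p q} → p ≢ 0ℚ → p * q ≡ 0ℚ → q ≡ 0ℚ
          zero-product {p} {q} p≢0 pq≡0 = begin
            q                  ≡⟨ *-identityˡ q ⟨
            1ℚ * q             ≡⟨ cong (_* q) (recip-inverse p≢0) ⟨
            recip p * p * q    ≡⟨ *-assoc (recip p) p q ⟩
            recip p * (p * q)  ≡⟨ cong (recip p *_) pq≡0 ⟩
            recip p * 0ℚ       ≡⟨ *-zeroʳ (recip p) ⟩
            0ℚ                 ∎
            where open ≡-Reasoning
        v≡0 : ∀ S → v S ≡ 0ℚ
        v≡0 S = trans (v≡σ*w S) (trans (cong (_* w S) σ≡0) (*-zeroˡ (w S)))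

  -- From a circuit with a relation to a simple minimal balanced collection

  module _ (Ψ : Collection n) (c : Weight n) where

    orientation : Subset n → Subset (suc n)
    orientation T = lift (neg? (c T)) T

    orient : Collection (suc n)
    orient = record
      { members = map orientation (members Ψ)
      ; unique  = Unique.map⁺
          (λ {T} {U} eq → trans (sym (base-lift (neg? (c T)) T)) (trans (cong base eq) (base-lift (neg? (c U)) U)))
          (unique Ψ)
      }

    size-orient : size orient ≡ size Ψ
    size-orient = length-map orientation (members Ψ)

    ∈-orient⁺ : ∀ {b T} → T ∈ members Ψ → b ≡ neg? (c T) → lift b T ∈ members orient
    ∈-orient⁺ T∈ refl = ∈-map⁺ orientation T∈

    ∈-orient⁻ : ∀ {b T} → lift b T ∈ members orient → T ∈ members Ψ × b ≡ neg? (c T)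
    ∈-orient⁻ {b} {T} T∈ with U , U∈ , eq ← ∈-map⁻ orientation T∈ =
      subst (_∈ members Ψ) U≡T U∈ , trans (sym (side-lift b T)) (trans (cong side eq)
        (trans (side-lift (neg? (c U)) U) (cong (neg? ∘ c) U≡T)))
      where
      U≡T : U ≡ T
      U≡T = trans (sym (base-lift (neg? (c U)) U)) (trans (cong base (sym eq)) (base-lift b T))

    orient-simple : All Nonempty (members Ψ) → Simple orient
    orient-simple nonempty U U⊆ = go (nonempty? U) U⊆
      where
      go : (d : Dec (Nonempty U)) → ¬ (pairOf d ⊆ members orient)
      go (yes _)    U⊆ with () ← trans (proj₂ (∈-orient⁻ {false} (U⊆ (here refl))))
                                (sym (proj₂ (∈-orient⁻ {true} (U⊆ (there (here refl))))))
      go (no empty) U⊆ = empty (All.lookup nonempty (proj₁ (∈-orient⁻ {true} (U⊆ (here refl)))))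

    module _ (nonempty : All Nonempty (members Ψ)) (el : Elementary NonzeroRelation Ψ)
             (c-rel : NonzeroRelation c) (c⊆Ψ : SupportedOn c Ψ) where

      private
        opposite∉ : ∀ {T} → lift (not (neg? (c T))) T ∉ members orient
        opposite∉ T∈ = not-¬ refl (sym (proj₂ (∈-orient⁻ T∈)))

        magnitude : Weight (suc n)
        magnitude S = ∣ c (base S) ∣

        -- The side chosen by `orientation` restores, under `reduce`, the sign lost in taking ∣ c T
        -- ∣. As `reduce μ` is the relation c, all coordinates of the total of `μ` agree.
        μ : Weight (suc n)
        μ = restrict orient magnitude

        μ-lift : ∀ {T} → T ∈ members Ψ → μ (orientation T) ≡ ∣ c T ∣
        μ-lift {T} T∈ = trans (restrict-∈ orient magnitude (∈-orient⁺ T∈ refl)) (cong (∣_∣ ∘ c) (base-lift (neg? (c T)) T))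

        reduce-μ : ∀ T → reduce μ T ≡ c T
        reduce-μ T = trans (reduce-one-sided μ (neg? (c T)) (restrict-∉ orient magnitude opposite∉)) (go (T ∈? members Ψ))
          where
          go : Dec (T ∈ members Ψ) → signed (neg? (c T)) (μ (orientation T)) ≡ c T
          go (yes T∈) = trans (cong (signed (neg? (c T))) (μ-lift T∈)) (signed-abs (c T))
          go (no T∉)  = trans (cong (signed (neg? (c T))) (restrict-∉ orient magnitude (T∉ ∘ proj₁ ∘ ∈-orient⁻)))
            (trans (signed-zero (neg? (c T))) (sym (vanishes {Φ = Ψ} c⊆Ψ T∉)))

        μ≥0 : ∀ S → 0ℚ ≤ μ S
        μ≥0 = restrict-nonNeg orient magnitude λ {S} _ → 0≤∣p∣ (c (base S))

        σ : ℚ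
        σ = total μ zero

        -- If σ vanished, then no c T would be negative, so the relation c would
        -- have non-negative terms.
        σ≢0 : σ ≢ 0ℚ
        σ≢0 σ≡0 = let T , cT≢0 = proj₂ c-rel ; i , i∈ = All.lookup nonempty (c⊆Ψ cT≢0) in
          cT≢0 (trans (sym (*-identityʳ (c T))) (trans (cong (c T *_) (sym (χ-∈ i∈)))
            (∑-nonNeg-zero (subsets n) (λ U → term≥0 U i) (proj₁ c-rel i) (∈-subsets T))))
          where
          μ-true≡0 : ∀ T → μ (lift true T) ≡ 0ℚ
          μ-true≡0 T = ∑-nonNeg-zero (subsets n) (λ T → μ≥0 (lift true T)) (trans (sym (total-zero μ)) σ≡0) (∈-subsets T)
          c≥0 : ∀ T → 0ℚ ≤ c T
          c≥0 T = subst (0ℚ ≤_) (reduce-μ T) (subst (λ z → 0ℚ ≤ μ (lift false T) - z) (sym (μ-true≡0 T))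
            (≤-trans (μ≥0 (lift false T)) (≤-reflexive (sym (+-identityʳ _)))))
          term≥0 : ∀ T i → 0ℚ ≤ c T * χ T i
          term≥0 T i = 0≤* (c≥0 T) (χ-nonNeg T i)

        0<σ : 0ℚ < σ
        0<σ = ≤∧≢⇒< (∑-nonNeg (subsets (suc n)) λ S → 0≤* (μ≥0 S) (χ-nonNeg S zero)) (σ≢0 ∘ sym)

        -- The summand with factor 0 gives the scaling the form required by `total-linear` and
        -- `SupportedOn-combination`.
        normalised : Weight (suc n)
        normalised S = recip σ * μ S + 0ℚ * μ S

        normalised-balanced : BalancedWeight normalised
        normalised-balanced =
          (λ S → ≤-trans (0≤* (recip-nonNeg 0<σ) (μ≥0 S))
                   (≤-reflexive (trans (sym (+-identityʳ _)) (cong (recip σ * μ S +_) (sym (*-zeroˡ (μ S))))))) ,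
          λ i → trans (total-linear (recip σ) 0ℚ μ μ i) (trans (cong₂ _+_ (cong (recip σ *_) (total-μ i)) (*-zeroˡ (total μ i)))
                   (trans (+-identityʳ _) (recip-inverse σ≢0)))
          where
          total-μ : ∀ i → total μ i ≡ σ
          total-μ zero    = refl
          total-μ (suc i) = trans (total-suc μ i)
            (trans (cong (σ +_) (trans (total-cong reduce-μ i) (proj₁ c-rel i))) (+-identityʳ σ))

      -- A balanced weight with a zero at one member reduces to a relation on Ψ with a zero at the
      -- corresponding base, hence to zero. Since only one set over each base belongs to `orient`,
      -- the weight itself is then zero and cannot be balanced.
      orient-elementary : Elementary BalancedWeight orient
      orient-elementary = (normalised , normalised-balanced
        , SupportedOn-combination (recip σ) 0ℚ μ μ {Φ = orient}
            (restrict-supported orient magnitude) (restrict-supported orient magnitude)) , full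
        where
        full : ∀ w → BalancedWeight w → SupportedOn w orient → ∀ {S} → S ∈ members orient → w S ≢ 0ℚ
        full w w-bal w⊆ S∈ wS≡0 with T , T∈ , refl ← ∈-map⁻ orientation S∈ =
          not-balanced zero w-bal λ S → trans (cong (_* χ S zero) (w≡0 S)) (*-zeroˡ (χ S zero))
          where
          reduce-w : ∀ T → reduce w T ≡ signed (neg? (c T)) (w (orientation T))
          reduce-w T = reduce-one-sided w (neg? (c T)) (vanishes {Φ = orient} w⊆ opposite∉)
          reduce-w⊆Ψ : SupportedOn (reduce w) Ψ
          reduce-w⊆Ψ {T} r≢0 = decidable-stable (T ∈? members Ψ) λ T∉ →
            r≢0 (trans (reduce-w T)
              (trans (cong (signed (neg? (c T))) (vanishes {Φ = orient} w⊆ (T∉ ∘ proj₁ ∘ ∈-orient⁻)))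
                (signed-zero (neg? (c T)))))
          reduce-w≡0 : ∀ T → reduce w T ≡ 0ℚ
          reduce-w≡0 = relation-vanishes {Φ = Ψ} el
            (reduce-relation {w = w} λ i → trans (proj₂ w-bal i) (sym (proj₂ w-bal zero))) reduce-w⊆Ψ T∈
            (trans (reduce-w T) (trans (cong (signed (neg? (c T))) wS≡0) (signed-zero (neg? (c T)))))
          w≡0 : ∀ S → w S ≡ 0ℚ
          w≡0 S = decidable-stable (w S ≟ 0ℚ) λ wS≢0 → let U , _ , eq = ∈-map⁻ orientation (w⊆ wS≢0) in
            wS≢0 (trans (cong w eq) (signed≡0 (neg? (c U)) (trans (sym (reduce-w U)) (reduce-w≡0 U))))

  -- Recovering collections from circuits and signs

  orient-base : ∀ {Ψ Ψ′ : Collection n} {c c′} → orient Ψ c ≈ orient Ψ′ c′ → Ψ ≈ Ψ′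
  orient-base {Ψ = Ψ} {Ψ′} {c} {c′} eq = ⊆-antisym
    (λ T∈ → proj₁ (∈-orient⁻ Ψ′ c′ (≈⇒⊆ eq (∈-orient⁺ Ψ c T∈ refl))))
    (λ T∈ → proj₁ (∈-orient⁻ Ψ c (≈⇒⊇ eq (∈-orient⁺ Ψ′ c′ T∈ refl))))

  orient-neg? : ∀ {Ψ Ψ′ : Collection n} {c c′} → orient Ψ c ≈ orient Ψ′ c′ →
    ∀ {T} → T ∈ members Ψ → neg? (c T) ≡ neg? (c′ T)
  orient-neg? {Ψ = Ψ} {Ψ′} {c} {c′} eq T∈ = proj₂ (∈-orient⁻ Ψ′ c′ (≈⇒⊆ eq (∈-orient⁺ Ψ c T∈ refl)))

  module _ {Φ : Collection (suc n)} (simple : Simple Φ) (el : Elementary BalancedWeight Φ) where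

    -- Only the signs of `d` matter, so a relation chosen once for each circuit can replace the one
    -- that comes from Φ.
    orient-bases : ∀ {Ψ d} → Ψ ≈ bases {Φ = Φ} simple el →
      (∀ {T} → T ∈ members Ψ → neg? (relation-of {Φ = Φ} simple el T) ≡ neg? (d T)) → orient Ψ d ≈ Φ
    orient-bases {Ψ} {d} Ψ≈ signs = ⊆-antisym to from
      where
      c = relation-of {Φ = Φ} simple el
      to : members (orient Ψ d) ⊆ members Φ
      to S∈ with T , T∈ , refl ← ∈-map⁻ (orientation Ψ d) S∈
            with S′ , S′∈ , refl ← ∈-map⁻ base (≈⇒⊆ Ψ≈ T∈) =
        subst (_∈ members Φ) (trans (sym (lift-side-base S′))
          (cong (λ b → lift b (base S′)) (trans (neg?-relation-of {Φ = Φ} simple el S′∈) (signs T∈)))) S′∈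
      from : members Φ ⊆ members (orient Ψ d)
      from {S} S∈ = subst (_∈ members (orient Ψ d)) (lift-side-base S)
        (∈-orient⁺ Ψ d base∈ (trans (neg?-relation-of {Φ = Φ} simple el S∈) (signs base∈)))
        where
        base∈ : base S ∈ members Ψ
        base∈ = ≈⇒⊇ Ψ≈ (∈-map⁺ base S∈)

  Elementary-≈ : ∀ {X : Weight N → Set} {Φ Ψ} → Φ ≈ Ψ → Elementary X Φ → Elementary X Ψ
  Elementary-≈ eq ((w , Xw , w⊆Φ) , full) =
    (w , Xw , ≈⇒⊆ eq ∘ w⊆Φ) , λ v Xv v⊆Ψ S∈ → full v Xv (≈⇒⊇ eq ∘ v⊆Ψ) (≈⇒⊇ eq S∈)

  -- Subtracting from `d` the multiple of `c` that agrees with it at `T₀` leaves a relation with a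
  -- zero on the circuit, which must vanish everywhere.
  relations-proportional : ∀ {Ψ : Collection n} → Elementary NonzeroRelation Ψ →
    ∀ {c d} → NonzeroRelation c → SupportedOn c Ψ → NonzeroRelation d → SupportedOn d Ψ →
    ∃[ t ] t ≢ 0ℚ × (∀ T → d T ≡ t * c T)
  relations-proportional {Ψ = Ψ} el@(_ , full) {c} {d} c-rel@(_ , T₀ , cT₀≢0) c⊆Ψ d-rel d⊆Ψ =
    t , t≢0 , λ T → trans (split (d T) t (c T)) (trans (cong (_+ t * c T) (difference≡0 T)) (+-identityˡ _))
    where
    open +-*-Solver
    t : ℚ
    t = d T₀ * recip (c T₀)
    t*c : t * c T₀ ≡ d T₀
    t*c = trans (*-assoc (d T₀) (recip (c T₀)) (c T₀)) (trans (cong (d T₀ *_) (recip-inverse cT₀≢0)) (*-identityʳ (d T₀)))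
    t≢0 : t ≢ 0ℚ
    t≢0 t≡0 = full d d-rel d⊆Ψ (c⊆Ψ cT₀≢0) (trans (sym t*c) (trans (cong (_* c T₀) t≡0) (*-zeroˡ (c T₀))))
    split : ∀ a b c → a ≡ (1ℚ * a + (- b) * c) + b * c
    split = solve 3 (λ a b c → a := (con 1ℚ :* a :+ (:- b) :* c) :+ b :* c) refl
    cancel : ∀ a b → 1ℚ * (a * b) + (- a) * b ≡ 0ℚ
    cancel = solve 2 (λ a b → con 1ℚ :* (a :* b) :+ (:- a) :* b := con 0ℚ) refl
    difference≡0 : ∀ T → 1ℚ * d T + (- t) * c T ≡ 0ℚ
    difference≡0 = relation-vanishes {Φ = Ψ} el (Relation-combination 1ℚ (- t) d c (proj₁ d-rel) (proj₁ c-rel))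
      (SupportedOn-combination 1ℚ (- t) d c {Φ = Ψ} d⊆Ψ c⊆Ψ) (c⊆Ψ cT₀≢0)
      (trans (cong (λ z → 1ℚ * z + (- t) * c T₀) (sym t*c)) (cancel t (c T₀)))

  neg?-* : ∀ {t} → 0ℚ < t → ∀ q → neg? (t * q) ≡ neg? q
  neg?-* {t} 0<t q with <-cmp q 0ℚ
  ... | tri< q<0 _ _ = trans
    (dec-true (t * q <? 0ℚ) (<-≤-trans (*-monoʳ-<-pos t {{positive 0<t}} q<0) (≤-reflexive (*-zeroʳ t))))
    (sym (dec-true (q <? 0ℚ) q<0))
  ... | tri≈ q≮0 q≡0 _ = cong neg? (trans (cong (t *_) q≡0) (trans (*-zeroʳ t) (sym q≡0)))
  ... | tri> q≮0 _ 0<q = trans (neg?-signed false (0<* 0<t 0<q)) (sym (neg?-signed false 0<q))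

  -- Scaling by ∣ t ∣ keeps every sign, so only the sign of `t` counts. This leaves two sign
  -- patterns for each circuit and is the source of the factor 2.
  proportional-signs : ∀ {t} → t ≢ 0ℚ → ∃[ b ] (∀ q → neg? (t * q) ≡ neg? (signed b q))
  proportional-signs {t} t≢0 = neg? t , λ q → trans
    (cong neg? (trans (cong (_* q) (sym (signed-abs t))) (move (neg? t) ∣ t ∣ q)))
    (neg?-* 0<∣ t≢0 ∣ (signed (neg? t) q))
    where
    move : ∀ b p q → signed b p * q ≡ p * signed b q
    move false p q = refl
    move true  p q = trans (sym (neg-distribˡ-* p q)) (neg-distribʳ-* p q)

  -- Counting

  ≈-refl : {Φ : Collection N} → Φ ≈ Φ
  ≈-refl = ⊆-antisym (λ S∈ → S∈) (λ S∈ → S∈)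

  ≈-sym : {Φ Ψ : Collection N} → Φ ≈ Ψ → Ψ ≈ Φ
  ≈-sym (⊆-antisym Φ⊆Ψ Ψ⊆Φ) = ⊆-antisym Ψ⊆Φ Φ⊆Ψ

  ≈-trans : {Φ Ψ Ξ : Collection N} → Φ ≈ Ψ → Ψ ≈ Ξ → Φ ≈ Ξ
  ≈-trans (⊆-antisym Φ⊆Ψ Ψ⊆Φ) (⊆-antisym Ψ⊆Ξ Ξ⊆Ψ) = ⊆-antisym (λ S∈ → Ψ⊆Ξ (Φ⊆Ψ S∈)) (λ S∈ → Ψ⊆Φ (Ξ⊆Ψ S∈))

  size-≈ : ∀ {Φ Ψ : Collection N} → Φ ≈ Ψ → size Φ ≡ size Ψ
  size-≈ {Φ = Φ} {Ψ} eq = ↭-length (unique∧set⇒↭ (unique Φ) (unique Ψ) (≈⇒⊆ eq) (≈⇒⊇ eq))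

  lookup-injective : ∀ {A : Set} {R : A → A → Set} {xs} → (∀ {x y} → R x y → R y x) →
    AllPairs (λ x y → ¬ R x y) xs → ∀ {i j} → R (List.lookup xs i) (List.lookup xs j) → i ≡ j
  lookup-injective R-sym (x∉ ∷ xs!) {zero}  {zero}  eq = refl
  lookup-injective R-sym (x∉ ∷ xs!) {zero}  {suc j} eq = contradiction eq (All.lookup x∉ (∈-lookup j))
  lookup-injective R-sym (x∉ ∷ xs!) {suc i} {zero}  eq = contradiction (R-sym eq) (All.lookup x∉ (∈-lookup i))
  lookup-injective R-sym (x∉ ∷ xs!) {suc i} {suc j} eq = cong suc (lookup-injective R-sym xs! eq)

  -- A listing up to `_≈_` without repetitions; `count` turns it into the inverse pair demanded by
  -- `Count`.
  record Enumeration (P : Collection N → Set) (k : ℕ) : Set where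
    field
      element    : Fin k → Collection N
      holds      : ∀ i → P (element i)
      injective  : ∀ {i j} → element i ≈ element j → i ≡ j
      surjective : ∀ Φ → P Φ → ∃[ i ] element i ≈ Φ

  open Enumeration

  count : ∀ {N k} {P : Collection N → Set} → Enumeration P k → Count P k
  count {N} E = record
    { to        = λ (Φ , PΦ) → proj₁ (surjective E Φ PΦ)
    ; from      = λ i → element E i , holds E i
    ; to-cong   = λ { {Φ , PΦ} {Ψ , PΨ} Φ≈Ψ → injective E (≈-trans (proj₂ (surjective E Φ PΦ))
        (≈-trans (fromSetoid Φ≈Ψ) (≈-sym (proj₂ (surjective E Ψ PΨ))))) }
    ; from-cong = λ { {i} refl → toSetoid (≈-refl {Φ = element E i}) }
    ; inverse   = (λ { {i} {Φ , PΦ} Φ≈ → injective E (≈-trans (proj₂ (surjective E Φ PΦ)) (fromSetoid Φ≈)) })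
                , (λ { {Φ , PΦ} refl → toSetoid (proj₂ (surjective E Φ PΦ)) })
    }
    where
    toSetoid : ∀ {Φ Ψ : Collection N} → Φ ≈ Ψ → Setoid._≈_ (CollectionSetoid N) Φ Ψ
    toSetoid eq = mk⇔ (≈⇒⊆ eq) (≈⇒⊇ eq)
    fromSetoid : ∀ {Φ Ψ : Collection N} → Setoid._≈_ (CollectionSetoid N) Φ Ψ → Φ ≈ Ψ
    fromSetoid eq = ⊆-antisym (Equivalence.to eq) (Equivalence.from eq)

  enumeration-⇔ : ∀ {P Q : Collection N → Set} → (∀ {Φ} → P Φ → Q Φ) → (∀ {Φ} → Q Φ → P Φ) →
    Enumeration P k → Enumeration Q k
  enumeration-⇔ P⇒Q Q⇒P E = record
    { element    = element E
    ; holds      = P⇒Q ∘ holds E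
    ; injective  = injective E
    ; surjective = λ Φ QΦ → surjective E Φ (Q⇒P QΦ)
    }

  enumeration-⊎ : ∀ {P Q : Collection N → Set} → (∀ {Φ Ψ} → P Φ → Q Ψ → ¬ (Φ ≈ Ψ)) →
    Enumeration P k → Enumeration Q l → Enumeration (λ Φ → P Φ ⊎ Q Φ) (k ℕ.+ l)
  enumeration-⊎ {k = k} {l} {P} {Q} disjoint E F = record
    { element    = elem ∘ splitAt k
    ; holds      = λ i → elem-holds (splitAt k i)
    ; injective  = λ {i} {j} eq → trans (sym (Fin.join-splitAt k l i))
        (trans (cong (Fin.join k l) (elem-injective (splitAt k i) (splitAt k j) eq)) (Fin.join-splitAt k l j))
    ; surjective = λ where
        Φ (inj₁ PΦ) → let i , eq = surjective E Φ PΦ in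
          i ↑ˡ l , subst (λ s → elem s ≈ Φ) (sym (Fin.splitAt-↑ˡ k i l)) eq
        Φ (inj₂ QΦ) → let j , eq = surjective F Φ QΦ in
          k ↑ʳ j , subst (λ s → elem s ≈ Φ) (sym (Fin.splitAt-↑ʳ k l j)) eq
    }
    where
    elem : Fin k ⊎ Fin l → Collection _
    elem = [ element E , element F ]′
    elem-holds : ∀ s → P (elem s) ⊎ Q (elem s)
    elem-holds (inj₁ i) = inj₁ (holds E i)
    elem-holds (inj₂ j) = inj₂ (holds F j)
    elem-injective : ∀ s t → elem s ≈ elem t → s ≡ t
    elem-injective (inj₁ i) (inj₁ j) eq = cong inj₁ (injective E eq)
    elem-injective (inj₂ i) (inj₂ j) eq = cong inj₂ (injective F eq)
    elem-injective (inj₁ i) (inj₂ j) eq = contradiction eq (disjoint (holds E i) (holds F j))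
    elem-injective (inj₂ i) (inj₁ j) eq = contradiction (≈-sym eq) (disjoint (holds E j) (holds F i))

  -- A collection is a subset of the set of all subsets, so `subsets` is reused one level up to list
  -- all collections.
  decode : ∀ {N} → Subset (length (subsets N)) → Collection N
  decode {N} v = record
    { members = filter (λ S → Vec.lookup v (index (∈-subsets S)) Bool.≟ true) (subsets N)
    ; unique  = Unique.filter⁺ (λ S → Vec.lookup v (index (∈-subsets S)) Bool.≟ true) (subsets-unique N)
    }

  collections : ∀ N → List (Collection N)
  collections N = map decode (subsets (length (subsets N)))

  ∈-collections : ∀ (Φ : Collection N) → ∃[ Ψ ] Ψ ∈ collections N × Ψ ≈ Φ
  ∈-collections {N} Φ = decode v , ∈-map⁺ decode (∈-subsets v) , ⊆-antisym
    (λ {S} S∈ → does⇒∈ (S ∈? members Φ) (trans (sym (lookup-v S))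
      (proj₂ (∈-filter⁻ (λ S → Vec.lookup v (index (∈-subsets S)) Bool.≟ true) {xs = subsets N} S∈))))
    (λ {S} S∈ → ∈-filter⁺ (λ S → Vec.lookup v (index (∈-subsets S)) Bool.≟ true) (∈-subsets S)
      (trans (lookup-v S) (dec-true (S ∈? members Φ) S∈)))
    where
    v : Subset (length (subsets N))
    v = Vec.tabulate λ i → does (List.lookup (subsets N) i ∈? members Φ)
    lookup-v : ∀ S → Vec.lookup v (index (∈-subsets S)) ≡ does (S ∈? members Φ)
    lookup-v S = trans (lookup∘tabulate _ (index (∈-subsets S)))
      (cong (λ T → does (T ∈? members Φ)) (sym (Any.lookup-index (∈-subsets S))))
    does⇒∈ : ∀ {S} (d : Dec (S ∈ members Φ)) → does d ≡ true → S ∈ members Φ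
    does⇒∈ (yes S∈) _ = S∈

  _⊆?_ : ∀ (Φ Ψ : Collection N) → Dec (members Φ ⊆ members Ψ)
  Φ ⊆? Ψ = map′ All.lookup All.tabulate (All.all? (_∈? members Ψ) (members Φ))

  _≈?_ : (Φ Ψ : Collection N) → Dec (Φ ≈ Ψ)
  Φ ≈? Ψ with Φ ⊆? Ψ | Ψ ⊆? Φ
  ... | yes Φ⊆Ψ | yes Ψ⊆Φ = yes (⊆-antisym Φ⊆Ψ Ψ⊆Φ)
  ... | no Φ⊈Ψ  | _       = no λ eq → Φ⊈Ψ (≈⇒⊆ eq)
  ... | _       | no Ψ⊈Φ  = no λ eq → Ψ⊈Φ (≈⇒⊇ eq)

  _⊂?_ : ∀ (Φ Ψ : Collection N) → Dec (Φ ⊂ Ψ)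
  Φ ⊂? Ψ = (Φ ⊆? Ψ) ×-dec ¬? (Ψ ⊆? Φ)

  -- The listed collections represent all others only up to `_≈_`, whence `resp`. Applied to
  -- circuits, this yields κ; the balanced collections are then enumerated from the circuits.
  enumerate : ∀ {P : Collection N → Set} → (∀ Φ → Dec (P Φ)) → (∀ {Φ Ψ} → Φ ≈ Ψ → P Φ → P Ψ) →
    ∃[ k ] Enumeration P k
  enumerate {N} {P} P? resp = length Φs , record
    { element    = List.lookup Φs
    ; holds      = λ i → All.lookup (All.deduplicate⁺ _≈?_ (All.all-filter P? (collections N))) (∈-lookup i)
    ; injective  = lookup-injective (λ {Φ} {Ψ} → ≈-sym) (UniqueDec.deduplicate-! decSetoid (filter P? (collections N)))
    ; surjective = λ Φ PΦ → let found = some Φ PΦ in index found , Any.lookup-index found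
    }
    where
    Φs : List (Collection N)
    Φs = deduplicate _≈?_ (filter P? (collections N))
    decSetoid : DecSetoid _ _
    decSetoid = record { isDecEquivalence = record
      { isEquivalence = record { refl = ≈-refl ; sym = ≈-sym ; trans = ≈-trans } ; _≟_ = _≈?_ } }
    some : ∀ Φ → P Φ → Any (_≈ Φ) Φs
    some Φ PΦ with Ψ , Ψ∈ , Ψ≈Φ ← ∈-collections Φ =
      Any.deduplicate⁺ _≈?_ (λ {Φ₁} {Φ₂} Φ₂≈Φ₁ Φ₁≈Φ → ≈-trans Φ₂≈Φ₁ Φ₁≈Φ)
        (lose (∈-filter⁺ P? Ψ∈ (resp (≈-sym Ψ≈Φ) PΦ)) Ψ≈Φ)

  -- Deciding circuits, and passing between collections and weights

  dependent-mono : ∀ {Φ Ψ : Collection N} → members Φ ⊆ members Ψ → LinearlyDependent Φ → LinearlyDependent Ψ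
  dependent-mono {Φ = Φ} {Ψ} Φ⊆Ψ dep =
    let c , c-rel , c⊆Φ = dependent⇒relation Φ dep in relation⇒dependent Ψ c-rel (Φ⊆Ψ ∘ c⊆Φ)

  -- Minimality speaks of all collections, but dependence is invariant under `_≈_`, so testing the
  -- finite list `collections N` suffices.
  circuit? : (Φ : Collection N) → Dec (Circuit Φ)
  circuit? {N} Φ = All.all? nonempty? (members Φ) ×-dec (dependent? Φ ×-dec
    map′ to (λ minimal → All.tabulate λ {Ψ} _ (Ψ⊂Φ , dep) → minimal Ψ Ψ⊂Φ dep)
      (All.all? (λ Ψ → ¬? ((Ψ ⊂? Φ) ×-dec dependent? Ψ)) (collections N)))
    where
    to : All (λ Ψ → ¬ (Ψ ⊂ Φ × LinearlyDependent Ψ)) (collections N) → ∀ Ψ → Ψ ⊂ Φ → ¬ LinearlyDependent Ψ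
    to none Ψ (Ψ⊆Φ , Φ⊈Ψ) dep = let Ψ′ , Ψ′∈ , eq = ∈-collections Ψ in
      All.lookup none Ψ′∈ ((Ψ⊆Φ ∘ ≈⇒⊆ eq , λ Φ⊆Ψ′ → Φ⊈Ψ (≈⇒⊆ eq ∘ Φ⊆Ψ′))
        , dependent-mono {Φ = Ψ} {Ψ′} (≈⇒⊇ eq) dep)

  -- Abstract, so that the elimination behind them does not unfold.
  abstract
    circuit⇒elementary : ∀ {Φ : Collection N} → Circuit Φ → Elementary NonzeroRelation Φ
    circuit⇒elementary {Φ = Φ} (_ , minimal) = minimal⇒elementary dependent⇒relation
      (λ Φ c-rel c⊆Φ _ → relation⇒dependent Φ c-rel c⊆Φ) {Φ} minimal

    minimalBalanced⇒elementary : ∀ {Φ : Collection N} → MinimalBalanced Φ → Elementary BalancedWeight Φ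
    minimalBalanced⇒elementary {Φ = Φ} = minimal⇒elementary balanced⇒balancedWeight balancedWeight⇒balanced {Φ}

  elementary⇒circuit : ∀ {Φ : Collection N} → All Nonempty (members Φ) → Elementary NonzeroRelation Φ → Circuit Φ
  elementary⇒circuit {Φ = Φ} nonempty el = nonempty ,
    elementary⇒minimal dependent⇒relation (λ Φ c-rel c⊆Φ _ → relation⇒dependent Φ c-rel c⊆Φ) {Φ} el

  circuit-≈ : ∀ {Φ Ψ : Collection N} → Φ ≈ Ψ → Circuit Φ → Circuit Ψ
  circuit-≈ {Φ = Φ} {Ψ} eq circuit = elementary⇒circuit {Φ = Ψ} (All.tabulate (All.lookup (proj₁ circuit) ∘ ≈⇒⊇ eq))
    (Elementary-≈ eq (circuit⇒elementary {Φ = Φ} circuit))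

  elementary⇒minimalBalanced : ∀ {Φ : Collection N} → Elementary BalancedWeight Φ → MinimalBalanced Φ
  elementary⇒minimalBalanced {Φ = Φ} = elementary⇒minimal balanced⇒balancedWeight balancedWeight⇒balanced {Φ}

  -- Counting the degenerate collections

  Degenerate : Collection (suc n) → Set
  Degenerate Φ = ∃[ U ] members (pair U) ⊆ members Φ

  -- Indexing by the member of the pair that avoids the extra element lists each pair once; the
  -- empty base accounts for {[n+1]}.
  degenerate-enumeration : ∀ n → Enumeration {suc n} (λ Φ → MinimalBalanced Φ × Degenerate Φ) (2 ℕ.^ n)
  degenerate-enumeration n = subst (Enumeration _) (length-subsets n) (record
    { element    = pair ∘ List.lookup (subsets n)
    ; holds      = λ i → let U = List.lookup (subsets n) i in
        elementary⇒minimalBalanced {Φ = pair U} (pair-elementary U) , U , λ S∈ → S∈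
    ; injective  = λ eq → lookup-injective sym (subsets-unique n) (pair-injective eq)
    ; surjective = λ Φ (minimal , U , U⊆Φ) → index (∈-subsets U) ,
        subst (λ V → pair V ≈ Φ) (Any.lookup-index (∈-subsets U))
          (≈-sym (degenerate⇒pair {Φ = Φ} {U} (minimalBalanced⇒elementary {Φ = Φ} minimal) U⊆Φ))
    })

  -- A collection that is not simple equals a pair and has at most two members. This is what the
  -- bound 3 ≤ m is for.
  simple-of-size : ∀ {Φ : Collection (suc n)} → MinimalBalanced Φ → 3 ℕ.≤ size Φ → Simple Φ
  simple-of-size {Φ = Φ} minimal 3≤ with simple? Φ
  ... | inj₁ simple     = simple
  ... | inj₂ (U , U⊆Φ) = contradiction
    (ℕ.≤-trans 3≤ (subst (ℕ._≤ 2)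
      (sym (size-≈ (degenerate⇒pair {Φ = Φ} {U} (minimalBalanced⇒elementary {Φ = Φ} minimal) U⊆Φ)))
      (length-pair U)))
    λ { (ℕ.s≤s (ℕ.s≤s ())) }

  SimpleMinimalBalanced : Collection (suc n) → Set
  SimpleMinimalBalanced Φ = MinimalBalanced Φ × Simple Φ

  -- Two simple minimal balanced collections for each circuit

  module _ {Q : ℕ → Set} (E : Enumeration {n} (λ Ψ → Circuit Ψ × Q (size Ψ)) k) where

    private
      Ψ : Fin k → Collection n
      Ψ = element E

      el : ∀ j → Elementary NonzeroRelation (Ψ j)
      el j = circuit⇒elementary {Φ = Ψ j} (proj₁ (holds E j))

      c : Bool → Fin k → Weight n
      c b j T = signed b (proj₁ (proj₁ (el j)) T)

      c-nonzero : ∀ j → NonzeroRelation (c false j)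
      c-nonzero j = proj₁ (proj₂ (proj₁ (el j)))

      c⊆Ψ : ∀ b j → SupportedOn (c b j) (Ψ j)
      c⊆Ψ b j cT≢0 = proj₂ (proj₂ (proj₁ (el j))) λ eq → cT≢0 (trans (cong (signed b) eq) (signed-zero b))

      c-rel : ∀ b j → NonzeroRelation (c b j)
      c-rel b j = signed-relation b , proj₁ (proj₂ (c-nonzero j)) , proj₂ (proj₂ (c-nonzero j)) ∘ signed≡0 b
        where
        signed-relation : ∀ b → Relation (c b j)
        signed-relation false = proj₁ (c-nonzero j)
        signed-relation true  = negate-relation (c false j) (proj₁ (c-nonzero j))

      balanced : Bool × Fin k → Collection (suc n)
      balanced (b , j) = orient (Ψ j) (c b j)

      balanced-holds : ∀ bj → SimpleMinimalBalanced (balanced bj) × Q (size (balanced bj))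
      balanced-holds (b , j) =
        ( elementary⇒minimalBalanced {Φ = balanced (b , j)}
            (orient-elementary (Ψ j) (c b j) nonempty (el j) (c-rel b j) (c⊆Ψ b j))
        , orient-simple (Ψ j) (c b j) nonempty)
        , subst Q (sym (size-orient (Ψ j) (c b j))) (proj₂ (holds E j))
        where
        nonempty : All Nonempty (members (Ψ j))
        nonempty = proj₁ (proj₁ (holds E j))

      -- The bases determine the circuit. On one circuit, the sign at a single member with nonzero
      -- coefficient distinguishes the relation from its negative.
      balanced-injective : ∀ bi b′j → balanced bi ≈ balanced b′j → bi ≡ b′j
      balanced-injective (b , i) (b′ , j) eq
        with refl ← injective E (orient-base {Ψ = Ψ i} {Ψ j} {c b i} {c b′ j} eq) = cong (_, i) (signs b b′ eq)
        where
        T : Subset n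
        T = proj₁ (proj₂ (c-nonzero i))
        cT≢0 : c false i T ≢ 0ℚ
        cT≢0 = proj₂ (proj₂ (c-nonzero i))
        same : ∀ {b b′} → balanced (b , i) ≈ balanced (b′ , i) → neg? (c b i T) ≡ neg? (c b′ i T)
        same {b} {b′} eq = orient-neg? {Ψ = Ψ i} {Ψ i} {c b i} {c b′ i} eq (c⊆Ψ false i cT≢0)
        signs : ∀ b b′ → balanced (b , i) ≈ balanced (b′ , i) → b ≡ b′
        signs false false eq = refl
        signs true  true  eq = refl
        signs false true  eq = contradiction (trans (same {false} {true} eq) (neg?-neg cT≢0)) (not-¬ refl)
        signs true  false eq = contradiction (trans (sym (same {true} {false} eq)) (neg?-neg cT≢0)) (not-¬ refl)

      -- The relation obtained from Φ is a multiple of the one chosen for its circuit, and the sign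
      -- of the factor selects `b`.
      balanced-surjective : ∀ Φ → SimpleMinimalBalanced Φ × Q (size Φ) → ∃[ bj ] balanced bj ≈ Φ
      balanced-surjective Φ ((minimal , simple) , q) = (b , j) , orient-bases {Φ = Φ} simple Φ-el {Ψ j} {c b j} eq
        λ {T} _ → trans (cong neg? (proj₂ (proj₂ proportional) T)) (proj₂ signs (c false j T))
        where
        Φ-el : Elementary BalancedWeight Φ
        Φ-el = minimalBalanced⇒elementary {Φ = Φ} minimal
        Φ′ : Collection n
        Φ′ = bases {Φ = Φ} simple Φ-el
        found : ∃[ j ] Ψ j ≈ Φ′
        found = surjective E Φ′
          ( elementary⇒circuit {Φ = Φ′} (bases-nonempty {Φ = Φ} simple Φ-el) (bases-elementary {Φ = Φ} simple Φ-el)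
          , subst Q (sym (size-bases {Φ = Φ} simple Φ-el)) q)
        j : Fin k
        j = proj₁ found
        eq : Ψ j ≈ Φ′
        eq = proj₂ found
        proportional : ∃[ t ] t ≢ 0ℚ × (∀ T → relation-of {Φ = Φ} simple Φ-el T ≡ t * c false j T)
        proportional = relations-proportional {Ψ = Ψ j} (el j) (c-nonzero j) (c⊆Ψ false j)
          (relation-of-nonzero {Φ = Φ} simple Φ-el) (≈⇒⊇ eq ∘ relation-of-supported {Φ = Φ} simple Φ-el)
        signs : ∃[ b ] (∀ q → neg? (proj₁ proportional * q) ≡ neg? (signed b q))
        signs = proportional-signs (proj₁ (proj₂ proportional))
        b : Bool
        b = proj₁ signs

    -- Orientation preserves size, so one bijection serves both counts: `Q` is `_≡ m` for a fixed
    -- size and trivially true for the total.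
    simple-enumeration : Enumeration (λ Φ → SimpleMinimalBalanced Φ × Q (size Φ)) (2 ℕ.* k)
    simple-enumeration = record
      { element    = balanced ∘ decode₂
      ; holds      = balanced-holds ∘ decode₂
      ; injective  = λ {i} {j} eq → trans (sym (encode-decode i))
          (trans (cong encode (balanced-injective (decode₂ i) (decode₂ j) eq)) (encode-decode j))
      ; surjective = λ Φ p → let bj , eq = balanced-surjective Φ p in
          encode bj , subst (λ bj → balanced bj ≈ Φ) (sym (decode-encode bj)) eq
      }
      where
      open Inverse Fin.2↔Bool using (to; from; strictlyInverseˡ; strictlyInverseʳ)
      decode₂ : Fin (2 ℕ.* k) → Bool × Fin k
      decode₂ i = let s , j = remQuot {2} k i in to s , j
      encode : Bool × Fin k → Fin (2 ℕ.* k)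
      encode (b , j) = combine (from b) j
      encode-decode : ∀ i → encode (decode₂ i) ≡ i
      encode-decode i = trans
        (cong (λ s → combine s (proj₂ (remQuot {2} k i))) (strictlyInverseʳ (proj₁ (remQuot {2} k i))))
        (Fin.combine-remQuot {2} k i)
      decode-encode : ∀ bj → decode₂ (encode bj) ≡ bj
      decode-encode (b , j) = trans (cong (λ (s , j) → to s , j) (Fin.remQuot-combine (from b) j)) (cong (_, j) (strictlyInverseˡ b))

  circuits-of-size : ∀ n {Q : ℕ → Set} → (∀ m → Dec (Q m)) →
    ∃[ k ] Enumeration {n} (λ Ψ → Circuit Ψ × Q (size Ψ)) k
  circuits-of-size n {Q} Q? = enumerate (λ Ψ → circuit? Ψ ×-dec Q? (size Ψ))
    λ {Φ} {Ψ} eq (circuit , q) → circuit-≈ eq circuit , subst Q (size-≈ eq) q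

  B≡2κ : ∀ n m → 3 ℕ.≤ m → ∃₂ λ b k → B[_,_]=_ (suc n) m b × κ[_,_]=_ n m k × b ≡ 2 ℕ.* k
  B≡2κ n m 3≤m = let k , E = circuits-of-size n (ℕ._≟ m) in
    2 ℕ.* k , k , count (enumeration-⇔
      (λ ((minimal , _) , size≡m) → minimal , size≡m)
      (λ {Φ} (minimal , size≡m) → (minimal , simple-of-size {Φ = Φ} minimal (subst (3 ℕ.≤_) (sym size≡m) 3≤m)) , size≡m)
      (simple-enumeration {Q = _≡ m} E)) , count E , refl

  simple-not-degenerate : ∀ {n} {Φ Ψ : Collection (suc n)} → Degenerate Φ → Simple Ψ → ¬ (Φ ≈ Ψ)
  simple-not-degenerate (U , U⊆Φ) simple eq = simple U λ S∈ → ≈⇒⊆ eq (U⊆Φ S∈)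

  B≡2^n+2κ : ∀ n → ∃₂ λ b k → (B[_]=_ (suc n) b) × (κ[_]=_ n k) × b ≡ 2 ℕ.^ n ℕ.+ 2 ℕ.* k
  B≡2^n+2κ n = let k , E = circuits-of-size n {λ _ → ⊤} (λ _ → yes tt) in
    2 ℕ.^ n ℕ.+ 2 ℕ.* k , k
    , count (enumeration-⇔
        (λ { (inj₁ (minimal , _)) → minimal ; (inj₂ ((minimal , _) , _)) → minimal })
        (λ {Φ} minimal → split {Φ} minimal (simple? Φ))
        (enumeration-⊎
          (λ {Φ} {Ψ} (_ , degenerate) ((_ , simple) , _) → simple-not-degenerate {Φ = Φ} {Ψ} degenerate simple)
          (degenerate-enumeration n) (simple-enumeration {Q = λ _ → ⊤} E)))
    , count (enumeration-⇔ proj₁ (_, tt) E) , refl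
    where
    split : ∀ {Φ} → MinimalBalanced Φ → Simple Φ ⊎ Degenerate Φ →
      MinimalBalanced Φ × Degenerate Φ ⊎ SimpleMinimalBalanced Φ × ⊤
    split minimal (inj₁ simple)     = inj₂ ((minimal , simple) , tt)
    split minimal (inj₂ degenerate) = inj₁ (minimal , degenerate)

import Data.Nat.Properties as ℕ
import Data.Product as Product
open import Defs using (B[_,_]=_; B[_]=_; κ[_,_]=_; κ[_]=_)
open import Data.Nat using (ℕ; _+_; _*_; _^_; _≤_)
open import Data.Product using (_×_; ∃₂)
open import Relation.Binary.PropositionalEquality using (_≡_; subst)
open Proof using (B≡2κ; B≡2^n+2κ)

propositionD1 : (∀ (n m : ℕ) → 1 ≤ n → 3 ≤ m → m ≤ n + 1 →
    ∃₂ λ (b k : ℕ) → (B[ n + 1 , m ]= b) × (κ[ n , m ]= k) × b ≡ 2 * k)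
    × (∀ (n : ℕ) → 1 ≤ n →
    ∃₂ λ (b k : ℕ) → (B[ n + 1 ]= b) × (κ[ n ]= k) × b ≡ 2 ^ n + 2 * k)
propositionD1 = Product._,_
  (λ n m _ 3≤m _ → subst (λ N → ∃₂ λ b k → (B[ N , m ]= b) × (κ[ n , m ]= k) × b ≡ 2 * k)
    (ℕ.+-comm 1 n) (B≡2κ n m 3≤m))
  (λ n _ → subst (λ N → ∃₂ λ b k → (B[ N ]= b) × (κ[ n ]= k) × b ≡ 2 ^ n + 2 * k)
    (ℕ.+-comm 1 n) (B≡2^n+2κ n))
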